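{- Let $F$ be a minor-closed family of graphs which excludes a graph $M$ as a minor, where $M$ has $n$ vertices. Then there exists an infinite family of graphs $H_1,H_2,\dots$, each of treewidth at most $n+1$, such that for every $i$, any $\alpha$-approximation of the metric of $H_i$ by a distribution over dominating graph metrics of graphs in $F$ has $\alpha=\Omega(\log |H_i|)$, where the constant implicit in $\Omega$ may depend on $n$ (polynomially) but not on $i$.
   Context: Graphs carry their shortest-path metric (unit edge lengths). For a graph $H$ with metric $d_H$, an $\alpha$-approximation of $d_H$ by a distribution over dominating graph metrics in $F$ is a probability distribution over pairs $(U,\Phi_U)$, where $U\in F$ and $\Phi_U$ maps the vertices of $H$ to vertices of $U$, such that for all vertices $x,y$ of $H$: $d_U(\Phi_U(x),\Phi_U(y))\ge d_H(x,y)$ for every $U$ in the support (domination), and $\mathbb{E}[d_U(\Phi_U(x),\Phi_U(y))]\le \alpha\, d_H(x,y)$. $|H_i|$ denotes the size of $H_i$. -}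

module Defs where

open import Algebra.Bundles.Raw using (RawMonoid)
import Algebra.Definitions.RawMonoid as RawMonoidDefs
open import Data.Bool.Base using (Bool; T)
open import Data.Fin.Base using (Fin; toℕ)
open import Data.Fin.Subset using (Subset; ∣_∣) renaming (_∈_ to _∈ˢ_)
open import Data.List.Base using (List; _∷_; _∷ʳ_; length)
open import Data.List.Relation.Unary.Linked using (Linked)
open import Data.List.Relation.Unary.Unique.Propositional using (Unique)
open import Data.Maybe.Base using (Maybe; just)
open import Data.Nat.Base as ℕ using (ℕ; zero; suc)
import Data.Nat.Properties as ℕ
open import Data.Product.Base using (∃; ∃₂; _×_; _,_)
open import Data.Rational.Base using (ℚ; 0ℚ; 1ℚ; ½; _+_; _*_; _≤_; _<_)
import Data.Rational.Properties as ℚ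
open import Data.Unit.Base using (⊤)
open import Level using (Level; 0ℓ)
open import Relation.Binary.Construct.Closure.ReflexiveTransitive using (Star)
open import Relation.Binary.Core using (Rel)
open import Relation.Binary.PropositionalEquality
open import Relation.Nullary.Negation using (¬_)
open import Relation.Unary using (Pred)

private
  variable
    ℓ : Level

------------------------------------------------------------------------
-- Real numbers as Cauchy sequences of rationals.  Only the ordered
-- additive structure is needed: distances are natural numbers, so every
-- product below is a natural multiple of a real.

-- As m and n range over the same tail, the one-sided bound amounts to
-- ∣ seq m - seq n ∣ ≤ ε.
record ℝ : Set where
  field
    seq    : ℕ → ℚ
    cauchy : ∀ ε → 0ℚ < ε → ∃ λ N → ∀ m n → N ℕ.≤ m → N ℕ.≤ n →
             seq m ≤ seq n + ε

open ℝ public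

infix 4 _≤ℝ_ _<ℝ_ _≈ℝ_

_≤ℝ_ : Rel ℝ 0ℓ
x ≤ℝ y = ∀ ε → 0ℚ < ε → ∃ λ N → ∀ n → N ℕ.≤ n → seq x n ≤ seq y n + ε

_<ℝ_ : Rel ℝ 0ℓ
x <ℝ y = ∃ λ ε → 0ℚ < ε × ∃ λ N → ∀ n → N ℕ.≤ n → seq x n + ε ≤ seq y n

_≈ℝ_ : Rel ℝ 0ℓ
x ≈ℝ y = x ≤ℝ y × y ≤ℝ x

fromℚ : ℚ → ℝ
fromℚ q .seq _ = q
fromℚ q .cauchy ε 0<ε = 0 , λ _ _ _ _ →
  subst (_≤ q + ε) (ℚ.+-identityʳ q) (ℚ.+-monoʳ-≤ q (ℚ.<⇒≤ 0<ε))

0ℝ 1ℝ : ℝ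
0ℝ = fromℚ 0ℚ
1ℝ = fromℚ 1ℚ

private
  halve : ∀ ε → ε * ½ + ε * ½ ≡ ε
  halve ε = trans (sym (ℚ.*-distribˡ-+ ε ½ ½)) (ℚ.*-identityʳ ε)

  half-pos : ∀ {ε} → 0ℚ < ε → 0ℚ < ε * ½
  half-pos = ℚ.*-monoˡ-<-pos ½

  interchange : ∀ a b c d → (a + b) + (c + d) ≡ (a + c) + (b + d)
  interchange a b c d = begin
    (a + b) + (c + d)  ≡⟨ ℚ.+-assoc a b (c + d) ⟩
    a + (b + (c + d))  ≡⟨ cong (a +_) (ℚ.+-assoc b c d) ⟨
    a + ((b + c) + d)  ≡⟨ cong (λ t → a + (t + d)) (ℚ.+-comm b c) ⟩
    a + ((c + b) + d)  ≡⟨ cong (a +_) (ℚ.+-assoc c b d) ⟩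
    a + (c + (b + d))  ≡⟨ ℚ.+-assoc a c (b + d) ⟨
    (a + c) + (b + d)  ∎
    where open ≡-Reasoning

infixl 6 _+ℝ_

_+ℝ_ : ℝ → ℝ → ℝ
(x +ℝ y) .seq n = seq x n + seq y n
(x +ℝ y) .cauchy ε 0<ε
  with cauchy x (ε * ½) (half-pos 0<ε) | cauchy y (ε * ½) (half-pos 0<ε)
... | N₁ , p | N₂ , q = N₁ ℕ.⊔ N₂ , λ m n m≥ n≥ →
  subst (seq x m + seq y m ≤_)
    (trans (interchange (seq x n) (ε * ½) (seq y n) (ε * ½))
           (cong (seq x n + seq y n +_) (halve ε)))
    (ℚ.+-mono-≤ (p m n (ℕ.m⊔n≤o⇒m≤o N₁ N₂ m≥) (ℕ.m⊔n≤o⇒m≤o N₁ N₂ n≥))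
                (q m n (ℕ.m⊔n≤o⇒n≤o N₁ N₂ m≥) (ℕ.m⊔n≤o⇒n≤o N₁ N₂ n≥)))

+ℝ-rawMonoid : RawMonoid 0ℓ 0ℓ
+ℝ-rawMonoid = record
  { Carrier = ℝ ; _≈_ = _≈ℝ_ ; _∙_ = _+ℝ_ ; ε = 0ℝ }

open RawMonoidDefs +ℝ-rawMonoid public using (sum) renaming (_×_ to infixr 8 _·_)

fromℕ : ℕ → ℝ
fromℕ n = n · 1ℝ

partialSum : (ℕ → ℝ) → ℕ → ℝ
partialSum t N = sum {N} (λ j → t (toℕ j))

HasSum : (ℕ → ℝ) → ℝ → Set
HasSum t s = ∀ ε → 0ℚ < ε → ∃ λ N → ∀ n → N ℕ.≤ n →
  partialSum t n ≤ℝ s +ℝ fromℚ ε × s ≤ℝ partialSum t n +ℝ fromℚ ε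

-- For a series of nonnegative terms: its value in [0,∞] is at most c.
SumAtMost : (ℕ → ℝ) → ℝ → Set
SumAtMost t c = ∀ N → partialSum t N ≤ℝ c

------------------------------------------------------------------------
-- Finite simple graphs

record Graph : Set where
  field
    order  : ℕ
    adj    : Fin order → Fin order → Bool
    symm   : ∀ u v → T (adj u v) → T (adj v u)
    irrefl : ∀ u → ¬ T (adj u u)

  Vertex : Set
  Vertex = Fin order

  infix 4 _~_

  _~_ : Rel Vertex 0ℓ
  u ~ v = T (adj u v)

open Graph public using (order; Vertex)

data Walk (G : Graph) : Vertex G → Vertex G → ℕ → Set where
  []  : ∀ {u} → Walk G u u 0
  _∷_ : ∀ {u v w k} → Graph._~_ G u v → Walk G v w k → Walk G u w (suc k)

-- The shortest-path distance from u to v is k.  Distance G u v holds of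
-- no k when u and v lie in different components (distance ∞).
Distance : (G : Graph) → Vertex G → Vertex G → ℕ → Set
Distance G u v k = Walk G u v k × (∀ m → Walk G u v m → k ℕ.≤ m)

-- The subgraph of G induced by P is nonempty and connected.
ConnectedIn : (G : Graph) → Pred (Vertex G) 0ℓ → Set
ConnectedIn G P =
  ∃ P × (∀ u v → P u → P v → Star (λ x y → x ~ y × P x × P y) u v)
  where open Graph G using (_~_)

Connected : Graph → Set
Connected G = ConnectedIn G (λ _ → ⊤)

------------------------------------------------------------------------
-- Minors

-- M ≼ G: M is a minor of G.  The vertices with branch v ≡ just a form the
-- branch set contracted to a; those with branch v ≡ nothing are deleted.
infix 4 _≼_

record _≼_ (M G : Graph) : Set where
  open Graph using (_~_)
  field
    branch    : Vertex G → Maybe (Vertex M)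
    connected : ∀ a → ConnectedIn G (λ v → branch v ≡ just a)
    edge      : ∀ a b → _~_ M a b → ∃₂ λ u v →
                branch u ≡ just a × branch v ≡ just b × _~_ G u v

MinorClosed : Pred Graph ℓ → Set ℓ
MinorClosed F = ∀ M G → M ≼ G → F G → F M

infix 4 _Excludes_

_Excludes_ : Pred Graph ℓ → Graph → Set ℓ
F Excludes M = ∀ G → F G → ¬ (M ≼ G)

------------------------------------------------------------------------
-- Treewidth

record Cycle (G : Graph) : Set where
  field
    start  : Vertex G
    rest   : List (Vertex G)
    long   : 2 ℕ.≤ length rest
    simple : Unique (start ∷ rest)
    closed : Linked (Graph._~_ G) (start ∷ rest ∷ʳ start)

IsTree : Graph → Set
IsTree T = Connected T × ¬ Cycle T

record TreeDecomposition (G : Graph) : Set where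
  open Graph G using (_~_)
  field
    tree    : Graph
    isTree  : IsTree tree
    bag     : Vertex tree → Subset (order G)
    edge    : ∀ u v → u ~ v → ∃ λ t → u ∈ˢ bag t × v ∈ˢ bag t
    -- Nonemptiness, part of ConnectedIn, says that v lies in some bag.
    subtree : ∀ v → ConnectedIn tree (λ t → v ∈ˢ bag t)

TreewidthAtMost : ℕ → Graph → Set
TreewidthAtMost w G = ∃ λ (D : TreeDecomposition G) →
  let open TreeDecomposition D in ∀ t → ∣ bag t ∣ ℕ.≤ suc w

------------------------------------------------------------------------
-- Approximation by distributions over dominating graph metrics

-- A probability distribution over pairs (U , Φ) with U in F.  There are
-- only countably many such pairs, so every distribution is discrete and is
-- given by a sequence of atoms.  Atoms may repeat or have weight zero, so
-- finite supports are included.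
record Distribution (F : Pred Graph ℓ) (H : Graph) : Set ℓ where
  field
    U      : ℕ → Graph
    U∈F    : ∀ j → F (U j)
    Φ      : ∀ j → Vertex H → Vertex (U j)
    weight : ℕ → ℝ
    nonneg : ∀ j → 0ℝ ≤ℝ weight j
    total  : HasSum weight 1ℝ

  InSupport : ℕ → Set
  InSupport j = 0ℝ <ℝ weight j

-- Meant for connected H.  On the support the distances d_U(Φ x , Φ y) are
-- asked to be finite, which the expectation bound forces anyway; the value
-- of d at atoms of weight zero is immaterial.
record IsApproximation {F : Pred Graph ℓ} {H : Graph}
                       (α : ℝ) (D : Distribution F H) : Set where
  open Distribution D
  field
    d          : ℕ → Vertex H → Vertex H → ℕ
    isDistance : ∀ j → InSupport j → ∀ x y →
                 Distance (U j) (Φ j x) (Φ j y) (d j x y)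
    dominating : ∀ j → InSupport j → ∀ x y k →
                 Distance H x y k → k ℕ.≤ d j x y
    expected   : ∀ x y k → Distance H x y k →
                 SumAtMost (λ j → d j x y · weight j) (k · α)

{-# OPTIONS --safe #-}
-- F excludes K_{m+1}, where order M = m + 1.  Let H k arise from an edge by k
-- times replacing every edge by the paths s — a i — b j — t for i, j < m; a bag
-- {s, t, a 1, …, a m, b j} has m + 3 elements.  Each replaced edge contains a
-- model of K_{m+1} with branch sets {s} and {a i, b i}.  If, r + 2 subdivisions
-- later, each edge of such a model could be followed by a path all of whose
-- edges are stretched to less than 3 ^ r by a dominating map into U, then the
-- images of far apart parts of the model would be disjoint, as points of H k at
-- distance 3 ^ (r + 1) cannot be mapped closer than 2 · 3 ^ r, and U would have
-- the minor K_{m+1}.  As the m * m parallel paths are edge-disjoint, counting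
-- shows that for every r ≤ k - 3 a fraction of at least 1 / (27 m² 3 ^ r) of the
-- edges is stretched to 3 ^ r or more.  Hence all scales contribute equally to
-- the average stretch, which is of order (k - 2) / m², while log |H k| is
-- O(m² k).
module Submission where

open import Defs
open import Algebra.Bundles using (CommutativeMonoid)
import Algebra.Properties.CommutativeMonoid.Mult as CommutativeMonoidMult
import Algebra.Properties.CommutativeMonoid.Sum as CommutativeMonoidSum
import Algebra.Properties.Monoid.Mult as MonoidMult
open import Algebra.Structures using (IsCommutativeMonoid)
open import Data.Bool.Base using (if_then_else_)
open import Data.Fin.Base using (Fin; zero; suc; toℕ; inject₁)
open import Data.Fin.Patterns using (0F; 1F; 2F)
import Data.Fin.Properties as Fin
open import Data.Fin.Subset using (Subset; inside; outside; ⁅_⁆; _∪_; ∣_∣) renaming (_∈_ to _∈ˢ_; ⊥ to ∅)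
import Data.Fin.Subset.Properties as Subset
open import Data.List.Base using (List; []; _∷_; _∷ʳ_; _++_; length; map; concatMap; allFin)
open import Data.List.Membership.Propositional using (_∈_; lose)
open import Data.List.Membership.Propositional.Properties using (∈-allFin; ∈-concatMap⁺; ∈-map⁺; ∈-map⁻)
import Data.List.Properties as List
open import Data.List.Relation.Unary.All using (All; []; _∷_)
open import Data.List.Relation.Unary.AllPairs using ([]; _∷_)
open import Data.List.Relation.Unary.Any as Any using (here; there)
open import Data.List.Relation.Unary.Linked using (Linked; _∷_)
open import Data.List.Relation.Unary.Unique.Propositional using (Unique)
open import Data.Maybe.Base as Maybe using (Maybe; just; nothing)
import Data.Maybe.Properties as Maybe
open import Data.Nat.Base using (ℕ; zero; suc; _+_; _*_; _∸_; _^_; _⊔_; _≤_; _<_; z≤n; s≤s)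
open import Data.Nat.Induction using (<-rec)
open import Data.Nat.ListAction using () renaming (sum to sumᴸ)
open import Data.Nat.ListAction.Properties using (sum-++)
open import Data.Nat.Logarithm using (⌊log₂_⌋; ⌊log₂⌋-mono-≤; ⌊log₂[2^n]⌋≡n)
open import Data.Nat.Properties
open import Data.Nat.Tactic.RingSolver using (solve-∀)
open import Data.Product.Base using (∃; ∃₂; _×_; _,_; proj₁; proj₂)
open import Data.Product.Function.NonDependent.Propositional using (_×-↔_)
import Data.Product.Properties as Product
open import Data.Rational.Base as ℚ using (ℚ; 0ℚ; ½)
import Data.Rational.Properties as ℚ
open import Data.Sum.Base using (_⊎_; inj₁; inj₂; [_,_]; swap)
open import Data.Sum.Function.Propositional using (_⊎-↔_)
open import Data.Unit.Base using (⊤; tt)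
import Data.Vec.Base as Vec
open import Function.Base using (_∘_; id)
open import Function.Bundles using (_↔_; Inverse; mk↔ₛ′)
open import Function.Properties.Inverse using (↔-refl; ↔-sym; ↔-trans)
open import Level using (Level; 0ℓ)
open import Relation.Binary.Construct.Closure.ReflexiveTransitive as Star using (Star; ε; _◅_; _◅◅_; kleisliStar)
open import Relation.Binary.Core using (Rel)
open import Relation.Binary.Definitions using (DecidableEquality)
open import Relation.Binary.PropositionalEquality hiding ([_])
open import Relation.Nullary.Decidable.Core using (Dec; yes; no; does; isYes; toWitness; fromWitness; map′; _×-dec_; _⊎-dec_)
open import Relation.Nullary.Negation.Core using (¬_; contradiction)
open import Relation.Unary using (Pred)

-- The first two subdivisions of an edge serve the minor. One creates the paths s  -  a i  -  b j,
-- the next cuts each of their edges into thirds. An outer third joins the branch set of the end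
-- that it touches; a middle third becomes a strand between two branch sets, except that the one
-- from a i to b i also lies in a branch set. Any two parts that must stay disjoint in `U` then have
-- their ends on different sides of some vertex set, and the linearly interpolated 0-1 function of
-- that set certifies their distance. The obstacle is that edges become walks in `U` which leave the
-- image of `Φ`. Disjointness is therefore proved for neighbourhoods of the images of radius 3 ^ r,
-- and this is why a scale takes r + 1 subdivisions after those two. In 27 m² 3 ^ r, the failure of
-- a model gives one bad edge among the 3 m² that replace an edge, rather than one in each path,
-- which costs m². Each of the r + 3 subdivisions costs a factor 3, as only one edge of a path need
-- be bad; the stretch 3 ^ r pays for r of them and leaves 27.

-- Ordered additive arithmetic of the reals and averaging

halve : ∀ η → η ℚ.* ½ ℚ.+ η ℚ.* ½ ≡ η
halve η = trans (sym (ℚ.*-distribˡ-+ η ½ ½)) (ℚ.*-identityʳ η)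

half-pos : ∀ {η} → 0ℚ ℚ.< η → 0ℚ ℚ.< η ℚ.* ½
half-pos = ℚ.*-monoˡ-<-pos ½

p≤p+η : ∀ {η} p → 0ℚ ℚ.< η → p ℚ.≤ p ℚ.+ η
p≤p+η {η} p 0<η = subst (ℚ._≤ p ℚ.+ η) (ℚ.+-identityʳ p) (ℚ.+-monoʳ-≤ p (ℚ.<⇒≤ 0<η))

≤ℝ-pointwise : ∀ {x y} → (∀ n → seq x n ℚ.≤ seq y n) → x ≤ℝ y
≤ℝ-pointwise {x} {y} h η 0<η = 0 , λ n _ → ℚ.≤-trans (h n) (p≤p+η (seq y n) 0<η)

≤ℝ-refl : ∀ {x} → x ≤ℝ x
≤ℝ-refl {x} = ≤ℝ-pointwise {x} {x} (λ _ → ℚ.≤-refl)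

≤ℝ-trans : ∀ {x y z} → x ≤ℝ y → y ≤ℝ z → x ≤ℝ z
≤ℝ-trans {x} {y} {z} p q η 0<η
  with N₁ , p′ ← p (η ℚ.* ½) (half-pos 0<η) | N₂ , q′ ← q (η ℚ.* ½) (half-pos 0<η) =
  N₁ ⊔ N₂ , λ n n≥ → begin
    seq x n                               ≤⟨ p′ n (m⊔n≤o⇒m≤o N₁ N₂ n≥) ⟩
    seq y n ℚ.+ η ℚ.* ½                   ≤⟨ ℚ.+-monoˡ-≤ (η ℚ.* ½) (q′ n (m⊔n≤o⇒n≤o N₁ N₂ n≥)) ⟩
    (seq z n ℚ.+ η ℚ.* ½) ℚ.+ η ℚ.* ½     ≡⟨ ℚ.+-assoc (seq z n) _ _ ⟩
    seq z n ℚ.+ (η ℚ.* ½ ℚ.+ η ℚ.* ½)     ≡⟨ cong (seq z n ℚ.+_) (halve η) ⟩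
    seq z n ℚ.+ η                         ∎
  where open ℚ.≤-Reasoning

interchange : ∀ a b c d → (a ℚ.+ b) ℚ.+ (c ℚ.+ d) ≡ (a ℚ.+ c) ℚ.+ (b ℚ.+ d)
interchange a b c d = begin
  (a ℚ.+ b) ℚ.+ (c ℚ.+ d)  ≡⟨ ℚ.+-assoc a b (c ℚ.+ d) ⟩
  a ℚ.+ (b ℚ.+ (c ℚ.+ d))  ≡⟨ cong (a ℚ.+_) (ℚ.+-assoc b c d) ⟨
  a ℚ.+ ((b ℚ.+ c) ℚ.+ d)  ≡⟨ cong (λ t → a ℚ.+ (t ℚ.+ d)) (ℚ.+-comm b c) ⟩
  a ℚ.+ ((c ℚ.+ b) ℚ.+ d)  ≡⟨ cong (a ℚ.+_) (ℚ.+-assoc c b d) ⟩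
  a ℚ.+ (c ℚ.+ (b ℚ.+ d))  ≡⟨ ℚ.+-assoc a c (b ℚ.+ d) ⟨
  (a ℚ.+ c) ℚ.+ (b ℚ.+ d)  ∎
  where open ≡-Reasoning

+ℝ-mono-≤ : ∀ {x y u v} → x ≤ℝ y → u ≤ℝ v → x +ℝ u ≤ℝ y +ℝ v
+ℝ-mono-≤ {x} {y} {u} {v} p q η 0<η
  with N₁ , p′ ← p (η ℚ.* ½) (half-pos 0<η) | N₂ , q′ ← q (η ℚ.* ½) (half-pos 0<η) =
  N₁ ⊔ N₂ , λ n n≥ → begin
    seq x n ℚ.+ seq u n
      ≤⟨ ℚ.+-mono-≤ (p′ n (m⊔n≤o⇒m≤o N₁ N₂ n≥)) (q′ n (m⊔n≤o⇒n≤o N₁ N₂ n≥)) ⟩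
    (seq y n ℚ.+ η ℚ.* ½) ℚ.+ (seq v n ℚ.+ η ℚ.* ½)
      ≡⟨ interchange (seq y n) _ (seq v n) _ ⟩
    (seq y n ℚ.+ seq v n) ℚ.+ (η ℚ.* ½ ℚ.+ η ℚ.* ½)
      ≡⟨ cong ((seq y n ℚ.+ seq v n) ℚ.+_) (halve η) ⟩
    (seq y n ℚ.+ seq v n) ℚ.+ η
      ∎
  where open ℚ.≤-Reasoning

≈ℝ-pointwise : ∀ {x y} → (∀ n → seq x n ≡ seq y n) → x ≈ℝ y
≈ℝ-pointwise {x} {y} h =
  ≤ℝ-pointwise {x} {y} (ℚ.≤-reflexive ∘ h) , ≤ℝ-pointwise {y} {x} (ℚ.≤-reflexive ∘ sym ∘ h)

+ℝ-isCommutativeMonoid : IsCommutativeMonoid _≈ℝ_ _+ℝ_ 0ℝ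
+ℝ-isCommutativeMonoid = record
  { isMonoid = record
    { isSemigroup = record
      { isMagma = record
        { isEquivalence = record
          { refl  = λ {x} → ≤ℝ-refl {x} , ≤ℝ-refl {x}
          ; sym   = λ (p , q) → q , p
          ; trans = λ {x} {y} {z} (p , q) (p′ , q′) →
              ≤ℝ-trans {x} {y} {z} p p′ , ≤ℝ-trans {z} {y} {x} q′ q
          }
        ; ∙-cong = λ {x} {y} {u} {v} (p , q) (p′ , q′) →
            +ℝ-mono-≤ {x} {y} {u} {v} p p′ , +ℝ-mono-≤ {y} {x} {v} {u} q q′
        }
      ; assoc = λ x y z → ≈ℝ-pointwise {(x +ℝ y) +ℝ z} {x +ℝ (y +ℝ z)}
          λ n → ℚ.+-assoc (seq x n) (seq y n) (seq z n)
      }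
    ; identity =
        (λ x → ≈ℝ-pointwise {0ℝ +ℝ x} {x} (λ n → ℚ.+-identityˡ (seq x n))) ,
        (λ x → ≈ℝ-pointwise {x +ℝ 0ℝ} {x} (λ n → ℚ.+-identityʳ (seq x n)))
    }
  ; comm = λ x y → ≈ℝ-pointwise {x +ℝ y} {y +ℝ x} λ n → ℚ.+-comm (seq x n) (seq y n)
  }

+ℝ-commutativeMonoid : CommutativeMonoid 0ℓ 0ℓ
+ℝ-commutativeMonoid = record { isCommutativeMonoid = +ℝ-isCommutativeMonoid }

module +ℝ = CommutativeMonoid +ℝ-commutativeMonoid
open CommutativeMonoidSum +ℝ-commutativeMonoid using (∑-distrib-+)
open CommutativeMonoidMult +ℝ-commutativeMonoid using (×-distrib-+)
open MonoidMult +ℝ.monoid using (×-homo-+; ×-assocˡ; ×-congˡ)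

·-monoʳ-≤ : ∀ k {x y} → x ≤ℝ y → k · x ≤ℝ k · y
·-monoʳ-≤ zero            p = ≤ℝ-refl {0ℝ}
·-monoʳ-≤ (suc k) {x} {y} p = +ℝ-mono-≤ {x} {y} {k · x} {k · y} p (·-monoʳ-≤ k {x} {y} p)

0≤· : ∀ k {x} → 0ℝ ≤ℝ x → 0ℝ ≤ℝ k · x
0≤· zero        p = ≤ℝ-refl {0ℝ}
0≤· (suc k) {x} p = ≤ℝ-trans {0ℝ} {0ℝ +ℝ 0ℝ} {x +ℝ k · x} (proj₂ (+ℝ.identityˡ 0ℝ))
  (+ℝ-mono-≤ {0ℝ} {x} {0ℝ} {k · x} p (0≤· k {x} p))

·≤0 : ∀ k {x} → x ≤ℝ 0ℝ → k · x ≤ℝ 0ℝ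
·≤0 zero        p = ≤ℝ-refl {0ℝ}
·≤0 (suc k) {x} p = ≤ℝ-trans {x +ℝ k · x} {0ℝ +ℝ 0ℝ} {0ℝ}
  (+ℝ-mono-≤ {x} {0ℝ} {k · x} {0ℝ} p (·≤0 k {x} p)) (proj₁ (+ℝ.identityˡ 0ℝ))

·-monoˡ-≤ : ∀ {j k x} → 0ℝ ≤ℝ x → j ≤ k → j · x ≤ℝ k · x
·-monoˡ-≤ {k = k} {x} p z≤n = 0≤· k {x} p
·-monoˡ-≤ {suc j} {suc k} {x} p (s≤s q) =
  +ℝ-mono-≤ {x} {x} {j · x} {k · x} (≤ℝ-refl {x}) (·-monoˡ-≤ {x = x} p q)

sum-mono-≤ : ∀ {N} {s t : Fin N → ℝ} → (∀ i → s i ≤ℝ t i) → sum s ≤ℝ sum t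
sum-mono-≤ {zero}          h = ≤ℝ-refl {0ℝ}
sum-mono-≤ {suc N} {s} {t} h =
  +ℝ-mono-≤ {s zero} {t zero} {sum (s ∘ suc)} {sum (t ∘ suc)} (h zero) (sum-mono-≤ (h ∘ suc))

·-distrib-sum : ∀ k {N} (t : Fin N → ℝ) → k · sum t ≈ℝ sum (λ i → k · t i)
·-distrib-sum k {zero}  t = ·≤0 k {0ℝ} (≤ℝ-refl {0ℝ}) , 0≤· k {0ℝ} (≤ℝ-refl {0ℝ})
·-distrib-sum k {suc N} t = +ℝ.trans {k · (t zero +ℝ sum (t ∘ suc))} {k · t zero +ℝ k · sum (t ∘ suc)} {k · t zero +ℝ rest}
  (×-distrib-+ (t zero) (sum (t ∘ suc)) k)
  (+ℝ.∙-congˡ {k · t zero} {k · sum (t ∘ suc)} {rest} (·-distrib-sum k (t ∘ suc)))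
  where
  rest : ℝ
  rest = sum (λ i → k · t (suc i))

-- One late term is compared with `η * ½`. If it is larger, the whole tail stays above a positive
-- rational, which would make `x` positive.
≯0⇒≤0 : ∀ {x} → ¬ (0ℝ <ℝ x) → x ≤ℝ 0ℝ
≯0⇒≤0 {x} x≯0 η 0<η with N , c ← cauchy x (η ℚ.* ½) (half-pos 0<η)
  with seq x N ℚ.≤? η ℚ.* ½
... | yes xN≤ = N , λ n N≤n → begin
  seq x n                  ≤⟨ c n N N≤n ≤-refl ⟩
  seq x N ℚ.+ η ℚ.* ½      ≤⟨ ℚ.+-monoˡ-≤ (η ℚ.* ½) xN≤ ⟩
  η ℚ.* ½ ℚ.+ η ℚ.* ½      ≡⟨ halve η ⟩
  η                        ≡⟨ ℚ.+-identityˡ η ⟨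
  0ℚ ℚ.+ η                 ∎
  where open ℚ.≤-Reasoning
... | no  xN≰ = contradiction (δ ℚ.- η ℚ.* ½ , 0<δ-η/2 , N , bound) x≯0
  where
  δ = seq x N
  0<δ-η/2 : 0ℚ ℚ.< δ ℚ.- η ℚ.* ½
  0<δ-η/2 = subst (ℚ._< δ ℚ.- η ℚ.* ½) (ℚ.+-inverseʳ (η ℚ.* ½))
    (ℚ.+-monoˡ-< (ℚ.- (η ℚ.* ½)) (ℚ.≰⇒> xN≰))
  open ℚ.≤-Reasoning
  bound : ∀ n → N ≤ n → 0ℚ ℚ.+ (δ ℚ.- η ℚ.* ½) ℚ.≤ seq x n
  bound n N≤n = begin
    0ℚ ℚ.+ (δ ℚ.- η ℚ.* ½)                    ≡⟨ ℚ.+-identityˡ _ ⟩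
    δ ℚ.- η ℚ.* ½                             ≤⟨ ℚ.+-monoˡ-≤ (ℚ.- (η ℚ.* ½)) (c N n ≤-refl N≤n) ⟩
    (seq x n ℚ.+ η ℚ.* ½) ℚ.- η ℚ.* ½         ≡⟨ ℚ.+-assoc (seq x n) _ _ ⟩
    seq x n ℚ.+ (η ℚ.* ½ ℚ.- η ℚ.* ½)         ≡⟨ cong (seq x n ℚ.+_) (ℚ.+-inverseʳ (η ℚ.* ½)) ⟩
    seq x n ℚ.+ 0ℚ                            ≡⟨ ℚ.+-identityʳ _ ⟩
    seq x n                                   ∎

-- The sign of a real cannot be decided, so the natural numbers are compared instead: where `j ≤ k`
-- fails, `w` is not positive. This lets estimates that hold on the support be summed over all
-- atoms.
·-mono-support : ∀ j k {w} → 0ℝ ≤ℝ w → (0ℝ <ℝ w → j ≤ k) → j · w ≤ℝ k · w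
·-mono-support j k {w} 0≤w h with j ≤? k
... | yes j≤k = ·-monoˡ-≤ {x = w} 0≤w j≤k
... | no  j≰k = ≤ℝ-trans {j · w} {0ℝ} {k · w}
  (·≤0 j {w} (≯0⇒≤0 {w} (λ 0<w → j≰k (h 0<w)))) (0≤· k {w} 0≤w)

·-mono-< : ∀ k {x y} n → seq x n ℚ.< seq y n → seq (suc k · x) n ℚ.< seq (suc k · y) n
·-mono-< zero    n p = ℚ.+-mono-<-≤ p ℚ.≤-refl
·-mono-< (suc k) {x} {y} n p = ℚ.+-mono-< p (·-mono-< k {x} {y} n p)

-- If `x` exceeded `y + η` at a late index, the multiples would differ there by more than `η`,
-- because `suc k` is at least 1.
·-cancel-≤ : ∀ k {x y} → suc k · x ≤ℝ suc k · y → x ≤ℝ y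
·-cancel-≤ k {x} {y} h η 0<η with N , h′ ← h η 0<η = N , λ n N≤n →
  ℚ.≮⇒≥ (λ y+η<x → ℚ.<-irrefl refl (ℚ.<-≤-trans
    (·-mono-< k {y +ℝ fromℚ η} {x} n y+η<x)
    (ℚ.≤-trans (h′ n N≤n) (multiple n k))))
  where
  0≤kη : ∀ k n → 0ℚ ℚ.≤ seq (k · fromℚ η) n
  0≤kη zero    n = ℚ.≤-refl
  0≤kη (suc k) n = ℚ.+-mono-≤ (ℚ.<⇒≤ 0<η) (0≤kη k n)
  multiple : ∀ n k → seq (suc k · y) n ℚ.+ η ℚ.≤ seq (suc k · (y +ℝ fromℚ η)) n
  multiple n zero = ℚ.≤-reflexive
    (trans (cong (ℚ._+ η) (ℚ.+-identityʳ (seq y n))) (sym (ℚ.+-identityʳ _)))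
  multiple n (suc k) = begin
    (seq y n ℚ.+ seq (suc k · y) n) ℚ.+ η   ≡⟨ ℚ.+-assoc (seq y n) _ η ⟩
    seq y n ℚ.+ (seq (suc k · y) n ℚ.+ η)   ≤⟨ ℚ.+-mono-≤ (p≤p+η (seq y n) 0<η) (multiple n k) ⟩
    (seq y n ℚ.+ η) ℚ.+ seq (suc k · (y +ℝ fromℚ η)) n ∎
    where open ℚ.≤-Reasoning

-- Stands in for dividing `δ` by `k`. In `averaging` it keeps the weight missing from a partial sum
-- small even after multiplication by `a`.
small-multiple : ∀ k δ → 0ℚ ℚ.< δ → ∃ λ η → 0ℚ ℚ.< η × k · fromℚ η ≤ℝ fromℚ δ
small-multiple zero    δ 0<δ = δ , 0<δ , ≤ℝ-pointwise {0ℝ} {fromℚ δ} (λ _ → ℚ.<⇒≤ 0<δ)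
small-multiple (suc k) δ 0<δ with η , 0<η , kη≤ ← small-multiple k (δ ℚ.* ½) (half-pos 0<δ)
  with η ℚ.≤? δ ℚ.* ½
... | yes η≤ = η , 0<η ,
  ≤ℝ-trans {fromℚ η +ℝ k · fromℚ η} {fromℚ (δ ℚ.* ½) +ℝ fromℚ (δ ℚ.* ½)} {fromℚ δ}
    (+ℝ-mono-≤ {fromℚ η} {fromℚ (δ ℚ.* ½)} {k · fromℚ η} {fromℚ (δ ℚ.* ½)}
      (≤ℝ-pointwise {fromℚ η} {fromℚ (δ ℚ.* ½)} (λ _ → η≤)) kη≤)
    (≤ℝ-pointwise {fromℚ (δ ℚ.* ½) +ℝ fromℚ (δ ℚ.* ½)} {fromℚ δ} (λ _ → ℚ.≤-reflexive (halve δ)))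
... | no  η≰ = η′ , half-pos 0<δ ,
  ≤ℝ-trans {fromℚ η′ +ℝ k · fromℚ η′} {fromℚ η′ +ℝ fromℚ η′} {fromℚ δ}
    (+ℝ-mono-≤ {fromℚ η′} {fromℚ η′} {k · fromℚ η′} {fromℚ η′}
      (≤ℝ-refl {fromℚ η′})
      (≤ℝ-trans {k · fromℚ η′} {k · fromℚ η} {fromℚ η′}
        (·-monoʳ-≤ k {fromℚ η′} {fromℚ η} (≤ℝ-pointwise {fromℚ η′} {fromℚ η} (λ _ → ℚ.<⇒≤ (ℚ.≰⇒> η≰)))) kη≤))
    (≤ℝ-pointwise {fromℚ η′ +ℝ fromℚ η′} {fromℚ δ} (λ _ → ℚ.≤-reflexive (halve δ)))
  where η′ = δ ℚ.* ½

≤ℝ-approx : ∀ {x y} → (∀ δ → 0ℚ ℚ.< δ → x ≤ℝ y +ℝ fromℚ δ) → x ≤ℝ y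
≤ℝ-approx {x} {y} h η 0<η with N , p ← h (η ℚ.* ½) (half-pos 0<η) (η ℚ.* ½) (half-pos 0<η) =
  N , λ n N≤n → ℚ.≤-trans (p n N≤n) (ℚ.≤-reflexive
    (trans (ℚ.+-assoc (seq y n) _ _) (cong (seq y n ℚ.+_) (halve η))))

partialSum-linear : ∀ {A : Set} (w : ℕ → ℝ) (d : ℕ → A → ℕ) c xs N →
  (∀ x → partialSum (λ j → d j x · w j) N ≤ℝ c) →
  partialSum (λ j → sumᴸ (map (d j) xs) · w j) N ≤ℝ length xs · c
partialSum-linear w d c [] N h = proj₂ (·-distrib-sum 0 {N} (w ∘ toℕ))
partialSum-linear w d c (x ∷ xs) N h = ≤ℝ-trans
  {sum {N} λ j → (d (toℕ j) x + D (toℕ j)) · w (toℕ j)} {S₁ +ℝ S₂} {c +ℝ length xs · c}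
  (≤ℝ-trans {sum {N} λ j → (d (toℕ j) x + D (toℕ j)) · w (toℕ j)}
            {sum {N} λ j → d (toℕ j) x · w (toℕ j) +ℝ D (toℕ j) · w (toℕ j)} {S₁ +ℝ S₂}
    (sum-mono-≤ {N} (λ j → proj₁ (×-homo-+ (w (toℕ j)) (d (toℕ j) x) (D (toℕ j)))))
    (proj₁ (∑-distrib-+ {N} (λ j → d (toℕ j) x · w (toℕ j)) (λ j → D (toℕ j) · w (toℕ j)))))
  (+ℝ-mono-≤ {S₁} {c} {S₂} {length xs · c} (h x) (partialSum-linear w d c xs N h))
  where
  D : ℕ → ℕ
  D j = sumᴸ (map (d j) xs)
  S₁ S₂ : ℝ
  S₁ = partialSum (λ j → d j x · w j) N
  S₂ = partialSum (λ j → D j · w j) N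

-- Double counting of the expected total of `d` over `xs`: atom by atom it is at least `a / b`,
-- entry by entry at most `length xs` times `α`. Only finite partial sums are exchanged, and the
-- missing weight vanishes in the limit.
averaging : ∀ {A : Set} (w : ℕ → ℝ) (d : ℕ → A → ℕ) α xs a b →
  (∀ j → 0ℝ ≤ℝ w j) → HasSum w 1ℝ →
  (∀ x → SumAtMost (λ j → d j x · w j) α) →
  (∀ j → 0ℝ <ℝ w j → a ≤ b * sumᴸ (map (d j) xs)) →
  a · 1ℝ ≤ℝ (b * length xs) · α
averaging w d α xs a b 0≤w total expected stretch = ≤ℝ-approx {a · 1ℝ} {c · α} approx
  where
  c = b * length xs
  D : ℕ → ℕ
  D j = sumᴸ (map (d j) xs)

  weighted : ∀ N → a · partialSum w N ≤ℝ c · α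
  weighted N = ≤ℝ-trans {a · partialSum w N} {sum {N} λ j → (b * D (toℕ j)) · w (toℕ j)} {c · α}
    (≤ℝ-trans {a · partialSum w N} {sum {N} λ j → a · w (toℕ j)}
              {sum {N} λ j → (b * D (toℕ j)) · w (toℕ j)}
      (proj₁ (·-distrib-sum a {N} (w ∘ toℕ)))
      (sum-mono-≤ {N} λ j → ·-mono-support a (b * D (toℕ j)) {w (toℕ j)} (0≤w (toℕ j)) (stretch (toℕ j))))
    (≤ℝ-trans {sum {N} λ j → (b * D (toℕ j)) · w (toℕ j)} {sum {N} λ j → b · (D (toℕ j) · w (toℕ j))} {c · α}
      (sum-mono-≤ {N} λ j → proj₂ (×-assocˡ (w (toℕ j)) b (D (toℕ j))))
      (≤ℝ-trans {sum {N} λ j → b · (D (toℕ j) · w (toℕ j))} {b · S} {c · α}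
        (proj₂ (·-distrib-sum b {N} λ j → D (toℕ j) · w (toℕ j)))
        (≤ℝ-trans {b · S} {b · (length xs · α)} {c · α}
          (·-monoʳ-≤ b {S} {length xs · α} (partialSum-linear w d α xs N (λ x → expected x N)))
          (proj₁ (×-assocˡ α b (length xs))))))
    where
    S : ℝ
    S = partialSum (λ j → D j · w j) N

  approx : ∀ δ → 0ℚ ℚ.< δ → a · 1ℝ ≤ℝ c · α +ℝ fromℚ δ
  approx δ 0<δ with η , 0<η , aη≤δ ← small-multiple a δ 0<δ
    with N , close ← total η 0<η =
    ≤ℝ-trans {a · 1ℝ} {a · (partialSum w N +ℝ fromℚ η)} {c · α +ℝ fromℚ δ}
      (·-monoʳ-≤ a {1ℝ} {partialSum w N +ℝ fromℚ η} (proj₂ (close N ≤-refl)))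
      (≤ℝ-trans {a · (partialSum w N +ℝ fromℚ η)} {a · partialSum w N +ℝ a · fromℚ η} {c · α +ℝ fromℚ δ}
        (proj₁ (×-distrib-+ (partialSum w N) (fromℚ η) a))
        (+ℝ-mono-≤ {a · partialSum w N} {c · α} {a · fromℚ η} {fromℚ δ} (weighted N) aη≤δ))

fromℕ-cancel : ∀ {N l b x} → 0 < N → (l * N) · 1ℝ ≤ℝ (b * N) · x → fromℕ l ≤ℝ b · x
fromℕ-cancel {suc k} {l} {b} {x} _ h = ·-cancel-≤ k {fromℕ l} {b · x}
  (≤ℝ-trans {suc k · fromℕ l} {(l * suc k) · 1ℝ} {suc k · (b · x)}
    (≤ℝ-trans {suc k · fromℕ l} {(suc k * l) · 1ℝ} {(l * suc k) · 1ℝ}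
      (proj₁ (×-assocˡ 1ℝ (suc k) l)) (proj₁ (×-congˡ {1ℝ} (*-comm (suc k) l))))
    (≤ℝ-trans {(l * suc k) · 1ℝ} {(b * suc k) · x} {suc k · (b · x)} h
      (≤ℝ-trans {(b * suc k) · x} {(suc k * b) · x} {suc k · (b · x)}
        (proj₁ (×-congˡ {x} (*-comm b (suc k)))) (proj₂ (×-assocˡ x (suc k) b)))))

-- Walks and distances

infixr 5 _++ᵂ_

_++ᵂ_ : ∀ {G u v w j k} → Walk G u v j → Walk G v w k → Walk G u w (j + k)
[]       ++ᵂ q = q
(e ∷ p)  ++ᵂ q = e ∷ (p ++ᵂ q)

reverseᵂ : ∀ {G u v k} → Walk G u v k → Walk G v u k
reverseᵂ []              = []
reverseᵂ {G} {u} {v} {suc k} (e ∷ p) =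
  subst (Walk G v u) (+-comm k 1) (reverseᵂ p ++ᵂ (Graph.symm G _ _ e ∷ []))

Star⇒Walk : ∀ {G u v} {P : Pred (Vertex G) 0ℓ} →
  Star (λ x y → Graph._~_ G x y × P x × P y) u v → ∃ (Walk G u v)
Star⇒Walk ε                = 0 , []
Star⇒Walk ((e , _) ◅ es) = let k , p = Star⇒Walk es in suc k , e ∷ p

-- A shortest walk need not be found, as it is only used to reach a contradiction.
¬¬-distance : ∀ {G u v k} → Walk G u v k → ¬ (∀ l → ¬ Distance G u v l)
¬¬-distance {G} {u} {v} {k} p none = <-rec (λ k → ¬ Walk G u v k)
  (λ k shorter p → none k (p , λ m q → ≮⇒≥ λ m<k → shorter m<k q)) k p


-- Minor models

module _ {M U : Graph} where
  open Graph using (_~_)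

  -- The branch function is found by searching the finitely many vertices of `M`, hence `R?`.
  -- Connectedness is asked for from a hub only, since any two spokes concatenate.
  minorModel : (R : Vertex M → Pred (Vertex U) 0ℓ) → (∀ a y → Dec (R a y)) →
    (∀ {a b y} → R a y → R b y → a ≡ b) →
    (∀ a → ∃ λ c → R a c × (∀ y → R a y → Star (λ x y → _~_ U x y × R a x × R a y) c y)) →
    (∀ a b → _~_ M a b → ∃₂ λ u v → R a u × R b v × _~_ U u v) →
    M ≼ U
  minorModel R R? functional connected edge = record
    { branch    = branch
    ; connected = λ a → let c , Rc , spoke = connected a in
        (c , R⇒branch Rc) ,
        (λ u v bu bv → Star.map (λ (e , Rx , Ry) → e , R⇒branch Rx , R⇒branch Ry)
          (Star.reverse (λ (e , Rx , Ry) → Graph.symm U _ _ e , Ry , Rx) (spoke u (branch⇒R bu))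
            ◅◅ spoke v (branch⇒R bv)))
    ; edge      = λ a b e → let u , v , Ru , Rv , e′ = edge a b e in
        u , v , R⇒branch Ru , R⇒branch Rv , e′
    }
    where
    branch : Vertex U → Maybe (Vertex M)
    branch y with Fin.any? (λ a → R? a y)
    ... | yes (a , _) = just a
    ... | no _        = nothing

    branch⇒R : ∀ {a y} → branch y ≡ just a → R a y
    branch⇒R {y = y} eq with Fin.any? (λ a → R? a y) | eq
    ... | yes (a , Ra) | refl = Ra

    R⇒branch : ∀ {a y} → R a y → branch y ≡ just a
    R⇒branch {a} {y} Ra with Fin.any? (λ a → R? a y)
    ... | yes (b , Rb) = cong just (functional Rb Ra)
    ... | no none      = contradiction (a , Ra) none

  private
    Within : Pred (Vertex U) 0ℓ → Rel (Vertex U) 0ℓ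
    Within P x y = _~_ U x y × P x × P y

  -- The part of a walk in `Q` before it enters `B`. It is kept as a list because membership in a
  -- list is decidable, as branch sets require, while `Q` is an arbitrary predicate.
  record Prefix (Q B : Pred (Vertex U) 0ℓ) (u : Vertex U) : Set where
    field
      verts  : List (Vertex U)
      sound  : ∀ {z} → z ∈ verts → Q z × ¬ B z
      start  : u ∈ verts
      linked : ∀ {z} → z ∈ verts → Star (Within (_∈ verts)) u z
      exit   : ∃₂ λ z w → z ∈ verts × B w × _~_ U z w

  firstHit : ∀ {Q B : Pred (Vertex U) 0ℓ} {u v} → (∀ y → Dec (B y)) →
    Star (Within Q) u v → Q u → ¬ B u → B v → Prefix Q B u
  firstHit B? ε Qu ¬Bu Bv = contradiction Bv ¬Bu
  firstHit {u = u} B? (_◅_ {j = w} (e , _ , Qw) es) Qu ¬Bu Bv with B? w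
  ... | yes Bw = record
    { verts  = u ∷ []
    ; sound  = λ { (here refl) → Qu , ¬Bu }
    ; start  = here refl
    ; linked = λ { (here refl) → ε }
    ; exit   = u , w , here refl , Bw , e
    }
  ... | no ¬Bw = record
    { verts  = u ∷ Prefix.verts rest
    ; sound  = λ { (here refl) → Qu , ¬Bu ; (there z∈) → Prefix.sound rest z∈ }
    ; start  = here refl
    ; linked = λ { (here refl) → ε
                 ; (there z∈) → (e , here refl , there (Prefix.start rest)) ◅
                     Star.map (λ (e , x∈ , y∈) → e , there x∈ , there y∈) (Prefix.linked rest z∈) }
    ; exit   = let z , w , z∈ , Bw , e = Prefix.exit rest in z , w , there z∈ , Bw , e
    }
    where rest = firstHit B? es Qw ¬Bw Bv

  -- Each strand Q c joins A (l c) to A (r c); its part before A (r c) is added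
  -- to A (l c), so that the enlarged sets are joined by edges.
  strandModel :
    (A : Vertex M → Pred (Vertex U) 0ℓ) → (∀ a y → Dec (A a y)) →
    (∀ {a b y} → A a y → A b y → a ≡ b) →
    (∀ a → ∃ λ c → A a c × (∀ y → A a y → Star (Within (A a)) c y)) →
    (C : Set) → ({P : C → Set} → (∀ c → Dec (P c)) → Dec (∃ P)) →
    (l r : C → Vertex M) → (∀ c → l c ≢ r c) →
    (Q : C → Pred (Vertex U) 0ℓ) →
    (∀ c → ∃₂ λ u v → A (l c) u × A (r c) v × Q c u × Star (Within (Q c)) u v) →
    (∀ {c a y} → Q c y → A a y → a ≡ l c ⊎ a ≡ r c) →
    (∀ {c d y} → Q c y → Q d y → c ≡ d) →
    (∀ a b → _~_ M a b → (∃ λ c → l c ≡ a × r c ≡ b) ⊎ (∃ λ c → l c ≡ b × r c ≡ a)) →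
    M ≼ U
  strandModel A A? A-disjoint hub C anyC? l r l≢r Q strand QA QQ joined =
    minorModel R R? functional connected edge
    where
    prefix : ∀ c → Prefix (Q c) (A (r c)) (proj₁ (strand c))
    prefix c with u , v , Au , Av , Qu , es ← strand c =
      firstHit (A? (r c)) es Qu (λ Au′ → l≢r c (A-disjoint Au Au′)) Av
    verts : C → List (Vertex U)
    verts c = Prefix.verts (prefix c)

    R : Vertex M → Pred (Vertex U) 0ℓ
    R a y = A a y ⊎ ∃ λ c → l c ≡ a × y ∈ verts c

    R? : ∀ a y → Dec (R a y)
    R? a y = A? a y ⊎-dec anyC? (λ c → (l c Fin.≟ a) ×-dec Any.any? (y Fin.≟_) (verts c))

    mixed : ∀ {a c y} → A a y → y ∈ verts c → a ≡ l c
    mixed {a} {c} Ay y∈ with Qy , ¬Ar ← Prefix.sound (prefix c) y∈ with QA Qy Ay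
    ... | inj₁ eq   = eq
    ... | inj₂ refl = contradiction Ay ¬Ar

    functional : ∀ {a b y} → R a y → R b y → a ≡ b
    functional (inj₁ Aa) (inj₁ Ab) = A-disjoint Aa Ab
    functional (inj₁ Aa) (inj₂ (c , refl , y∈)) = mixed Aa y∈
    functional (inj₂ (c , refl , y∈)) (inj₁ Ab) = sym (mixed Ab y∈)
    functional (inj₂ (c , refl , y∈)) (inj₂ (d , refl , y∈′)) =
      cong l (QQ (proj₁ (Prefix.sound (prefix c) y∈)) (proj₁ (Prefix.sound (prefix d) y∈′)))

    connected : ∀ a → ∃ λ c → R a c × (∀ y → R a y → Star (λ x y → _~_ U x y × R a x × R a y) c y)
    connected a with c , Ac , spoke ← hub a = c , inj₁ Ac , reach
      where
      widen : ∀ {x y} → Star (Within (A a)) x y → Star (Within (R a)) x y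
      widen = Star.map (λ (e , Ax , Ay) → e , inj₁ Ax , inj₁ Ay)
      reach : ∀ y → R a y → Star (Within (R a)) c y
      reach y (inj₁ Ay) = widen (spoke y Ay)
      reach y (inj₂ (d , refl , y∈)) =
        widen (spoke _ (proj₁ (proj₂ (proj₂ (strand d))))) ◅◅
        Star.map (λ (e , x∈ , y∈) → e , inj₂ (d , refl , x∈) , inj₂ (d , refl , y∈))
          (Prefix.linked (prefix d) y∈)

    edge : ∀ a b → _~_ M a b → ∃₂ λ u v → R a u × R b v × _~_ U u v
    edge a b e with joined a b e
    ... | inj₁ (c , refl , refl) = let z , w , z∈ , Aw , e = Prefix.exit (prefix c) in
      z , w , inj₂ (c , refl , z∈) , inj₁ Aw , e
    ... | inj₂ (c , refl , refl) = let z , w , z∈ , Aw , e = Prefix.exit (prefix c) in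
      w , z , inj₁ Aw , inj₂ (c , refl , z∈) , Graph.symm U _ _ e

-- Acyclicity of rooted trees

module _ {G : Graph} where
  open Graph G using (_~_)

  NonBacktracking : List (Vertex G) → Set
  NonBacktracking (x ∷ y ∷ z ∷ zs) = x ≢ z × NonBacktracking (y ∷ z ∷ zs)
  NonBacktracking _                = ⊤

  unique⇒nonBacktracking : ∀ {xs e} → Unique xs → All (e ≢_) xs → NonBacktracking (xs ∷ʳ e)
  unique⇒nonBacktracking {[]}             _ _ = tt
  unique⇒nonBacktracking {_ ∷ []}         _ _ = tt
  unique⇒nonBacktracking {_ ∷ _ ∷ []}     _ (e≢x ∷ _) = e≢x ∘ sym , tt
  unique⇒nonBacktracking {_ ∷ _ ∷ _ ∷ _} ((_ ∷ x≢z ∷ _) ∷ u) (_ ∷ e≢) =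
    x≢z , unique⇒nonBacktracking u e≢

  lastOf : Vertex G → List (Vertex G) → Vertex G
  lastOf x []       = x
  lastOf x (y ∷ ys) = lastOf y ys

  all-lastOf : ∀ {P : Pred (Vertex G) 0ℓ} {x xs} → All P (x ∷ xs) → P (lastOf x xs)
  all-lastOf (p ∷ [])     = p
  all-lastOf (_ ∷ p ∷ ps) = all-lastOf (p ∷ ps)

  module _ (Up : Rel (Vertex G) 0ℓ) (depth : Vertex G → ℕ)
           (functional : ∀ {u v w} → Up u v → Up u w → v ≡ w)
           (deeper : ∀ {u v} → Up u v → depth v < depth u)
           (split : ∀ {u v} → u ~ v → Up u v ⊎ Up v u) where

    -- After a step down, a step up would lead back to the parent just left, as parents are unique.
    descend : ∀ {p q} qs {e} → Up q p → Linked _~_ (q ∷ qs ∷ʳ e) →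
      NonBacktracking (p ∷ q ∷ qs ∷ʳ e) → depth q < depth e × Up e (lastOf q qs)
    descend [] up (l ∷ _) (p≢e , _) with split l
    ... | inj₁ up′ = contradiction (functional up up′) p≢e
    ... | inj₂ dn  = deeper dn , dn
    descend (r ∷ qs) up (l ∷ ls) (p≢r , nb) with split l
    ... | inj₁ up′ = contradiction (functional up up′) p≢r
    ... | inj₂ dn  = let d , dn′ = descend qs dn ls nb in <-trans (deeper dn) d , dn′

    -- A non-backtracking walk climbs, then descends.
    climb : ∀ {p} ps {e} → Linked _~_ (p ∷ ps ∷ʳ e) → NonBacktracking (p ∷ ps ∷ʳ e) →
      depth e < depth p ⊎ Up e (lastOf p ps)
    climb [] (l ∷ _) _ with split l
    ... | inj₁ up = inj₁ (deeper up)
    ... | inj₂ dn = inj₂ dn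
    climb (q ∷ qs) (l ∷ ls) nb with split l
    ... | inj₂ dn = inj₂ (proj₂ (descend qs dn ls nb))
    ... | inj₁ up with climb qs ls (tail-nb qs nb)
      where
      tail-nb : ∀ {p q} qs {e} → NonBacktracking (p ∷ q ∷ qs ∷ʳ e) → NonBacktracking (q ∷ qs ∷ʳ e)
      tail-nb []      = proj₂
      tail-nb (_ ∷ _) = proj₂
    ...   | inj₁ d  = inj₁ (<-trans d (deeper up))
    ...   | inj₂ dn = inj₂ dn

    -- A cycle that begins downwards would end below its start. One that begins upwards would end
    -- above its start, or come down into it from its parent; that parent is the second vertex `x`,
    -- which would occur twice.
    acyclic : ¬ Cycle G
    acyclic record { rest = [] ; long = () }
    acyclic record { rest = _ ∷ [] ; long = s≤s () }
    acyclic record { start = s ; rest = x ∷ y ∷ zs ; simple = (s≢x ∷ s≢y ∷ s≢zs) ∷ (x≢ ∷ u) ; closed = l ∷ ls }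
      with split l
    ... | inj₂ dn = <-asym (deeper dn) (proj₁ (descend (y ∷ zs) dn ls nb))
      where nb = s≢y , unique⇒nonBacktracking (x≢ ∷ u) (s≢x ∷ s≢y ∷ s≢zs)
    ... | inj₁ up with climb (y ∷ zs) ls (unique⇒nonBacktracking (x≢ ∷ u) (s≢x ∷ s≢y ∷ s≢zs))
    ...   | inj₁ d  = <-asym d (deeper up)
    ...   | inj₂ dn = all-lastOf x≢ (functional up dn)

-- Graphs on finite types

module _ {A : Set} {n : ℕ} (iso : A ↔ Fin n) where
  open Inverse iso using (to; from)

  from∘to : ∀ x → from (to x) ≡ x
  from∘to x = Inverse.strictlyInverseʳ iso x

  to∘from : ∀ u → to (from u) ≡ u
  to∘from u = Inverse.strictlyInverseˡ iso u

  decEq : DecidableEquality A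
  decEq x y = map′ (λ eq → trans (sym (from∘to x)) (trans (cong from eq) (from∘to y))) (cong to)
    (to x Fin.≟ to y)

  module _ (J : Rel A 0ℓ) (J? : ∀ x y → Dec (J x y)) (irr : ∀ x → ¬ J x x) where

    Joined : Rel A 0ℓ
    Joined x y = J x y ⊎ J y x

    joined? : ∀ x y → Dec (Joined x y)
    joined? x y = J? x y ⊎-dec J? y x

    undirected : Graph
    undirected = record
      { order  = n
      ; adj    = λ u v → isYes (joined? (from u) (from v))
      ; symm   = λ u v e → fromWitness (swap (toWitness e))
      ; irrefl = λ u e → [ irr (from u) , irr (from u) ] (toWitness e)
      }

    open Graph undirected using (_~_)

    ~⁺ : ∀ {x y} → Joined x y → to x ~ to y
    ~⁺ {x} {y} j = fromWitness (subst₂ Joined (sym (from∘to x)) (sym (from∘to y)) j)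

    ~⁻ : ∀ {u v} → u ~ v → Joined (from u) (from v)
    ~⁻ = toWitness

    connectedIn : (P : Pred A 0ℓ) (P′ : Pred (Fin n) 0ℓ) →
      (∀ {x} → P x → P′ (to x)) → (∀ {u} → P′ u → P (from u)) →
      ∀ {c} → P c → (∀ {x} → P x → Star (λ x y → Joined x y × P x × P y) x c) →
      ConnectedIn undirected P′
    connectedIn P P′ P⇒P′ P′⇒P {c} Pc spoke = (to c , P⇒P′ Pc) , λ u v P′u P′v →
      toCentre P′u ◅◅ Star.reverse (λ (e , Px , Py) → Graph.symm undirected _ _ e , Py , Px) (toCentre P′v)
      where
      toCentre : ∀ {u} → P′ u → Star (λ x y → x ~ y × P′ x × P′ y) u (to c)
      toCentre {u} P′u = subst (λ u → Star (λ x y → x ~ y × P′ x × P′ y) u (to c)) (to∘from u)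
        (Star.gmap to (λ (j , Px , Py) → ~⁺ j , P⇒P′ Px , P⇒P′ Py) (spoke (P′⇒P P′u)))

-- Tree decompositions

fromList : ∀ {n} → List (Fin n) → Subset n
fromList []       = ∅
fromList (x ∷ xs) = ⁅ x ⁆ ∪ fromList xs

∈-fromList⁺ : ∀ {n} {x : Fin n} {xs} → x ∈ xs → x ∈ˢ fromList xs
∈-fromList⁺ {x = x} (here refl) = Subset.x∈p∪q⁺ (inj₁ (Subset.x∈⁅x⁆ x))
∈-fromList⁺ (there x∈)          = Subset.x∈p∪q⁺ (inj₂ (∈-fromList⁺ x∈))

∈-fromList⁻ : ∀ {n} {x : Fin n} xs → x ∈ˢ fromList xs → x ∈ xs
∈-fromList⁻ []       x∈ = contradiction x∈ Subset.∉⊥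
∈-fromList⁻ (y ∷ xs) x∈ with Subset.x∈p∪q⁻ ⁅ y ⁆ (fromList xs) x∈
... | inj₁ x∈y  = here (Subset.x∈⁅y⁆⇒x≡y y x∈y)
... | inj₂ x∈xs = there (∈-fromList⁻ xs x∈xs)

∣p∪q∣≤∣p∣+∣q∣ : ∀ {n} (p q : Subset n) → ∣ p ∪ q ∣ ≤ ∣ p ∣ + ∣ q ∣
∣p∪q∣≤∣p∣+∣q∣ Vec.[] Vec.[] = z≤n
∣p∪q∣≤∣p∣+∣q∣ (outside Vec.∷ p) (outside Vec.∷ q) = ∣p∪q∣≤∣p∣+∣q∣ p q
∣p∪q∣≤∣p∣+∣q∣ (outside Vec.∷ p) (inside  Vec.∷ q) =
  ≤-trans (s≤s (∣p∪q∣≤∣p∣+∣q∣ p q)) (≤-reflexive (sym (+-suc ∣ p ∣ ∣ q ∣)))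
∣p∪q∣≤∣p∣+∣q∣ (inside Vec.∷ p) (outside Vec.∷ q) = s≤s (∣p∪q∣≤∣p∣+∣q∣ p q)
∣p∪q∣≤∣p∣+∣q∣ (inside Vec.∷ p) (inside  Vec.∷ q) =
  s≤s (≤-trans (∣p∪q∣≤∣p∣+∣q∣ p q) (+-monoʳ-≤ ∣ p ∣ (n≤1+n ∣ q ∣)))

∣fromList∣≤length : ∀ {n} (xs : List (Fin n)) → ∣ fromList xs ∣ ≤ length xs
∣fromList∣≤length {n} [] = ≤-reflexive (Subset.∣⊥∣≡0 n)
∣fromList∣≤length (x ∷ xs) = ≤-trans (∣p∪q∣≤∣p∣+∣q∣ ⁅ x ⁆ (fromList xs))
  (+-mono-≤ (≤-reflexive (Subset.∣⁅x⁆∣≡1 x)) (∣fromList∣≤length xs))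

module _ {B : Set} {N : ℕ} (iso : B ↔ Fin N) (parent : B → Maybe B) (depth : B → ℕ)
         (deeper : ∀ {x y} → parent x ≡ just y → depth y < depth x) where
  open Inverse iso using (to; from)

  Below : Rel B 0ℓ
  Below x y = parent x ≡ just y

  below? : ∀ x y → Dec (Below x y)
  below? x y = Maybe.≡-dec (decEq iso) (parent x) (just y)

  below-irrefl : ∀ x → ¬ Below x x
  below-irrefl x up = <-irrefl refl (deeper up)

  rootedTree : Graph
  rootedTree = undirected iso Below below? below-irrefl

  -- Each step to a parent decreases the depth, so the climb stops, and it can stop only at `home`;
  -- `n` bounds its length.
  toHome : ∀ {P : Pred B 0ℓ} {home} →
    (∀ {x} → P x → x ≡ home ⊎ ∃ λ y → parent x ≡ just y × P y) →
    ∀ n {x} → depth x < n → P x →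
    Star (λ x y → Joined iso Below below? below-irrefl x y × P x × P y) x home
  toHome h (suc n) (s≤s d≤n) Px with h Px
  ... | inj₁ refl          = ε
  ... | inj₂ (y , up , Py) =
    (inj₁ up , Px , Py) ◅ toHome h n (≤-trans (deeper up) d≤n) Py

  subtreeConnected : (P : Pred B 0ℓ) (P′ : Pred (Fin N) 0ℓ) →
    (∀ {x} → P x → P′ (to x)) → (∀ {u} → P′ u → P (from u)) →
    ∀ {home} → P home →
    (∀ {x} → P x → x ≡ home ⊎ ∃ λ y → parent x ≡ just y × P y) →
    ConnectedIn rootedTree P′
  subtreeConnected P P′ f g Phome h =
    connectedIn iso Below below? below-irrefl P P′ f g Phome (toHome h _ ≤-refl)

  rootedTree-isTree : ∀ root → (∀ x → x ≡ root ⊎ ∃ λ y → parent x ≡ just y) → IsTree rootedTree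
  rootedTree-isTree root h =
    subtreeConnected (λ _ → ⊤) (λ _ → ⊤) _ _ {root} tt (λ {x} _ → climbs (h x)) ,
    acyclic {rootedTree} (λ u v → Below (from u) (from v)) (depth ∘ from)
      (λ {u} {v} {w} p q → trans (sym (to∘from iso v))
        (trans (cong to (Maybe.just-injective (trans (sym p) q))) (to∘from iso w)))
      deeper (λ e → ~⁻ iso Below below? below-irrefl e)
    where
    climbs : ∀ {x} → x ≡ root ⊎ ∃ (λ y → parent x ≡ just y) →
      x ≡ root ⊎ ∃ λ y → parent x ≡ just y × ⊤
    climbs (inj₁ eq)       = inj₁ eq
    climbs (inj₂ (y , up)) = inj₂ (y , up , tt)

  module _ {A : Set} {n : ℕ} (isoA : A ↔ Fin n)
           (J : Rel A 0ℓ) (J? : ∀ x y → Dec (J x y)) (irr : ∀ x → ¬ J x x) where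
    open Inverse isoA using () renaming (to to toA; from to fromA)

    -- The nodes whose bags contain a given `x` form a subtree: from each of them, climbing stays
    -- among them until `home x`, their common top.
    rootedTree-treewidth : ∀ {w} root → (∀ x → x ≡ root ⊎ ∃ λ y → parent x ≡ just y) →
      (bag : B → List A) → (∀ t → length (bag t) ≤ suc w) →
      (∀ {x y} → J x y → ∃ λ t → x ∈ bag t × y ∈ bag t) →
      (home : A → B) → (∀ x → x ∈ bag (home x)) →
      (∀ {x t} → x ∈ bag t → t ≡ home x ⊎ ∃ λ t′ → parent t ≡ just t′ × x ∈ bag t′) →
      TreewidthAtMost w (undirected isoA J J? irr)
    rootedTree-treewidth root isRoot bag small cover home ∈home up = record
      { tree    = rootedTree
      ; isTree  = rootedTree-isTree root isRoot
      ; bag     = bag′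
      ; edge    = λ u v e → cover′ (~⁻ isoA J J? irr e)
      ; subtree = λ v → subtreeConnected (λ t → fromA v ∈ bag t) (λ t → v ∈ˢ bag′ t)
          (λ {t} v∈ → ∈bag′⁺ (subst (λ t → fromA v ∈ bag t) (sym (from∘to iso t)) v∈))
          ∈bag′⁻ {home (fromA v)} (∈home (fromA v)) up
      } , λ t → ≤-trans (∣fromList∣≤length (map toA (bag (from t))))
                  (≤-trans (≤-reflexive (List.length-map toA (bag (from t)))) (small (from t)))
      where
      bag′ : Fin N → Subset n
      bag′ t = fromList (map toA (bag (from t)))

      ∈bag′⁺ : ∀ {v t} → fromA v ∈ bag (from t) → v ∈ˢ bag′ t
      ∈bag′⁺ {v} {t} v∈ = ∈-fromList⁺ (subst (_∈ map toA (bag (from t))) (to∘from isoA v) (∈-map⁺ toA v∈))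

      ∈bag′⁻ : ∀ {v t} → v ∈ˢ bag′ t → fromA v ∈ bag (from t)
      ∈bag′⁻ {v} {t} v∈ with x , x∈ , refl ← ∈-map⁻ toA (∈-fromList⁻ (map toA (bag (from t))) v∈) =
        subst (_∈ bag (from t)) (sym (from∘to isoA x)) x∈

      cover″ : ∀ {u v} → (∃ λ t → fromA u ∈ bag t × fromA v ∈ bag t) → ∃ λ t → u ∈ˢ bag′ t × v ∈ˢ bag′ t
      cover″ {u} {v} (t , u∈ , v∈) = to t ,
        ∈bag′⁺ (subst (λ t → fromA u ∈ bag t) (sym (from∘to iso t)) u∈) ,
        ∈bag′⁺ (subst (λ t → fromA v ∈ bag t) (sym (from∘to iso t)) v∈)

      cover′ : ∀ {u v} → J (fromA u) (fromA v) ⊎ J (fromA v) (fromA u) →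
        ∃ λ t → u ∈ˢ bag′ t × v ∈ˢ bag′ t
      cover′ (inj₁ j) = cover″ (cover j)
      cover′ (inj₂ j) = let t , v∈ , u∈ = cover″ (cover j) in t , u∈ , v∈

-- Sums over lists and the layer-cake estimate

private variable
  X Y : Set

∑ : {X : Set} → List X → (X → ℕ) → ℕ
∑ xs f = sumᴸ (map f xs)

∑-mono-≤ : ∀ xs {f g : X → ℕ} → (∀ x → f x ≤ g x) → ∑ xs f ≤ ∑ xs g
∑-mono-≤ []       h = z≤n
∑-mono-≤ (x ∷ xs) h = +-mono-≤ (h x) (∑-mono-≤ xs h)

∑-const : ∀ (xs : List X) c → ∑ xs (λ _ → c) ≡ length xs * c
∑-const []       c = refl
∑-const (x ∷ xs) c = cong (c +_) (∑-const xs c)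

∑-distrib-+ᴸ : ∀ xs (f g : X → ℕ) → ∑ xs (λ x → f x + g x) ≡ ∑ xs f + ∑ xs g
∑-distrib-+ᴸ []       f g = refl
∑-distrib-+ᴸ (x ∷ xs) f g = trans (cong (f x + g x +_) (∑-distrib-+ᴸ xs f g))
  (shuffle (f x) (g x) (∑ xs f) (∑ xs g))
  where
  shuffle : ∀ a b c d → a + b + (c + d) ≡ a + c + (b + d)
  shuffle = solve-∀

*-distrib-∑ : ∀ c xs (f : X → ℕ) → c * ∑ xs f ≡ ∑ xs (λ x → c * f x)
*-distrib-∑ c []       f = *-zeroʳ c
*-distrib-∑ c (x ∷ xs) f = trans (*-distribˡ-+ c (f x) (∑ xs f)) (cong (c * f x +_) (*-distrib-∑ c xs f))

∑-concatMap : ∀ (h : X → List Y) xs f → ∑ (concatMap h xs) f ≡ ∑ xs (λ x → ∑ (h x) f)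
∑-concatMap h []       f = refl
∑-concatMap h (x ∷ xs) f = begin
  sumᴸ (map f (h x ++ concatMap h xs))          ≡⟨ cong sumᴸ (List.map-++ f (h x) _) ⟩
  sumᴸ (map f (h x) ++ map f (concatMap h xs))  ≡⟨ sum-++ (map f (h x)) _ ⟩
  ∑ (h x) f + ∑ (concatMap h xs) f              ≡⟨ cong (∑ (h x) f +_) (∑-concatMap h xs f) ⟩
  ∑ (h x) f + ∑ xs (λ x → ∑ (h x) f)            ∎
  where open ≡-Reasoning

∑-∈ : ∀ {xs} {x : X} (f : X → ℕ) → x ∈ xs → f x ≤ ∑ xs f
∑-∈ f (here refl)    = m≤m+n _ _
∑-∈ f (there x∈xs) = ≤-trans (∑-∈ f x∈xs) (m≤n+m _ _)

n≤2^n : ∀ n → n ≤ 2 ^ n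
n≤2^n zero    = z≤n
n≤2^n (suc n) = +-mono-≤ (m^n>0 2 n) (≤-trans (n≤2^n n) (m≤m+n (2 ^ n) 0))

failures : {P : X → Set} → (∀ x → Dec (P x)) → X → ℕ
failures P? x = if does (P? x) then 0 else 1

failures-holds : {P : X → Set} (P? : ∀ x → Dec (P x)) {x : X} → P x → failures P? x ≡ 0
failures-holds P? {x} p with P? x
... | yes _ = refl
... | no ¬p = contradiction p ¬p

failures-¬ : {P : X → Set} (P? : ∀ x → Dec (P x)) {x : X} → ¬ P x → failures P? x ≡ 1
failures-¬ P? {x} ¬p with P? x
... | yes p = contradiction p ¬p
... | no  _ = refl

-- The part of the layer-cake decomposition of d at the scales 3 ^ r, r < R.
layers : ℕ → ℕ → ℕ
layers zero    d = 0
layers (suc R) d = layers R d + 3 ^ R * failures (_<? 3 ^ R) d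

layers≤3^ : ∀ R d → layers R d ≤ 3 ^ R
layers≤3^ zero    d = z≤n
layers≤3^ (suc R) d = +-mono-≤ (layers≤3^ R d) (begin
  3 ^ R * failures (_<? 3 ^ R) d   ≤⟨ *-monoʳ-≤ (3 ^ R) (failures≤1 (d <? 3 ^ R)) ⟩
  3 ^ R * 1                        ≡⟨ *-identityʳ _ ⟩
  3 ^ R                            ≤⟨ m≤m+n _ _ ⟩
  3 ^ R + (3 ^ R + 0)              ∎)
  where
  open ≤-Reasoning
  failures≤1 : ∀ {P : Set} (P? : Dec P) → (if does P? then 0 else 1) ≤ 1
  failures≤1 (yes _) = z≤n
  failures≤1 (no  _) = ≤-refl

-- The scales form a geometric series: if the top scale counts, then 3 ^ R is at most `d`, and all
-- lower scales together add at most 3 ^ R once more.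
layers≤2* : ∀ R d → layers R d ≤ 2 * d
layers≤2* zero    d = z≤n
layers≤2* (suc R) d with d <? 3 ^ R
... | yes d< rewrite failures-holds (_<? 3 ^ R) d< | *-zeroʳ (3 ^ R) | +-identityʳ (layers R d) = layers≤2* R d
... | no d≮ rewrite failures-¬ (_<? 3 ^ R) d≮ | *-identityʳ (3 ^ R) | +-identityʳ d =
  +-mono-≤ (≤-trans (layers≤3^ R d) (≮⇒≥ d≮)) (≮⇒≥ d≮)

-- The layers are summed by scale instead of by element; each of the `R` scales contributes at least
-- `K`.
∑-layers : ∀ R (xs : List X) (D : X → ℕ) K →
  (∀ r → r < R → K ≤ 3 ^ r * ∑ xs (failures (λ x → D x <? 3 ^ r))) →
  R * K ≤ 2 * ∑ xs D
∑-layers R xs D K h = begin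
  R * K                          ≤⟨ bound R ≤-refl ⟩
  ∑ xs (λ x → layers R (D x))    ≤⟨ ∑-mono-≤ xs (λ x → layers≤2* R (D x)) ⟩
  ∑ xs (λ x → 2 * D x)           ≡⟨ *-distrib-∑ 2 xs D ⟨
  2 * ∑ xs D                     ∎
  where
  open ≤-Reasoning
  bound : ∀ r → r ≤ R → r * K ≤ ∑ xs (λ x → layers r (D x))
  bound zero    _   = z≤n
  bound (suc r) r<R = begin
    K + r * K
      ≡⟨ +-comm K _ ⟩
    r * K + K
      ≤⟨ +-mono-≤ (bound r (<⇒≤ r<R)) (h r r<R) ⟩
    ∑ xs (λ x → layers r (D x)) + 3 ^ r * ∑ xs (failures (λ x → D x <? 3 ^ r))
      ≡⟨ cong (∑ xs (λ x → layers r (D x)) +_) (*-distrib-∑ (3 ^ r) xs _) ⟩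
    ∑ xs (λ x → layers r (D x)) + ∑ xs (λ x → 3 ^ r * failures (λ x → D x <? 3 ^ r) x)
      ≡⟨ ∑-distrib-+ᴸ xs _ _ ⟨
    ∑ xs (λ x → layers (suc r) (D x))
      ∎

-- Iterated subdivision and its edge indices

module Construction (m : ℕ) where

  private variable
    k q : ℕ

  -- Level k + 1 replaces every edge of level k by m * m parallel paths of
  -- length 3, src — a i — b j — tgt for i, j < m; these share the 2 m inner
  -- vertices but, as indices, no edge.
  data Edge : ℕ → Set where
    root : Edge 0
    sub  : Edge k → Fin m → Fin m → Fin 3 → Edge (suc k)

  data Vert : ℕ → Set where
    s t : Vert 0
    old : Vert k → Vert (suc k)
    a b : Edge k → Fin m → Vert (suc k)

  src tgt : Edge k → Vert k
  src root           = s
  src (sub e i j 0F) = old (src e)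
  src (sub e i j 1F) = a e i
  src (sub e i j 2F) = b e j
  tgt root           = t
  tgt (sub e i j 0F) = a e i
  tgt (sub e i j 1F) = b e j
  tgt (sub e i j 2F) = old (tgt e)

  children : Edge k → List (Edge (suc k))
  children e = concatMap (λ i → concatMap (λ j → map (sub e i j) (allFin 3)) (allFin m)) (allFin m)

  edges : ∀ k → List (Edge k)
  edges zero    = root ∷ []
  edges (suc k) = concatMap children (edges k)

  ∈-children : ∀ (e : Edge k) i j p → sub e i j p ∈ children e
  ∈-children e i j p = ∈-concatMap⁺ _ (lose (∈-allFin i) (∈-concatMap⁺ _ (lose (∈-allFin j) (∈-map⁺ (sub e i j) (∈-allFin p)))))

  ∑-children : ∀ (e : Edge k) f →
    ∑ (children e) f ≡ ∑ (allFin m) λ i → ∑ (allFin m) λ j → ∑ (allFin 3) (f ∘ sub e i j)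
  ∑-children e f = trans (∑-concatMap _ (allFin m) f) (cong sumᴸ (List.map-cong (λ i →
    trans (∑-concatMap _ (allFin m) f) (cong sumᴸ (List.map-cong (λ j →
      cong sumᴸ (sym (List.map-∘ {g = f} {f = sub e i j} (allFin 3)))) (allFin m)))) (allFin m)))

  ∑-children-≥ : ∀ (e : Edge k) f v → (∀ i j → v ≤ ∑ (allFin 3) (f ∘ sub e i j)) →
    m * m * v ≤ ∑ (children e) f
  ∑-children-≥ e f v h = begin
    m * m * v                                          ≡⟨ *-assoc m m v ⟩
    m * (m * v)                                        ≡⟨ ∑-allFin (m * v) ⟨
    ∑ (allFin m) (λ i → m * v)                         ≤⟨ ∑-mono-≤ (allFin m) inner ⟩
    (∑ (allFin m) λ i → ∑ (allFin m) λ j → ∑ (allFin 3) (f ∘ sub e i j)) ≡⟨ ∑-children e f ⟨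
    ∑ (children e) f                                   ∎
    where
    open ≤-Reasoning
    ∑-allFin : ∀ c → ∑ (allFin m) (λ _ → c) ≡ m * c
    ∑-allFin c = trans (∑-const (allFin m) c) (cong (_* c) (List.length-tabulate {n = m} id))
    inner : ∀ i → m * v ≤ ∑ (allFin m) λ j → ∑ (allFin 3) (f ∘ sub e i j)
    inner i = subst (_≤ ∑ (allFin m) λ j → ∑ (allFin 3) (f ∘ sub e i j)) (∑-allFin v) (∑-mono-≤ (allFin m) (h i))

  edgeCount : ℕ → ℕ
  edgeCount zero    = 1
  edgeCount (suc k) = edgeCount k * (m * m * 3)

  length-edges : ∀ k → length (edges k) ≡ edgeCount k
  length-edges zero    = refl
  length-edges (suc k) = begin
    length (edges (suc k))                            ≡⟨ *-identityʳ _ ⟨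
    length (edges (suc k)) * 1                        ≡⟨ ∑-const (edges (suc k)) 1 ⟨
    ∑ (edges (suc k)) (λ _ → 1)                       ≡⟨ ∑-concatMap children (edges k) _ ⟩
    ∑ (edges k) (λ e → ∑ (children e) (λ _ → 1))      ≡⟨ cong sumᴸ (List.map-cong three (edges k)) ⟩
    ∑ (edges k) (λ e → m * m * 3)                     ≡⟨ ∑-const (edges k) _ ⟩
    length (edges k) * (m * m * 3)                    ≡⟨ cong (_* (m * m * 3)) (length-edges k) ⟩
    edgeCount k * (m * m * 3)                         ∎
    where
    open ≡-Reasoning
    three : ∀ (e : Edge k) → ∑ (children e) (λ _ → 1) ≡ m * m * 3
    three e = trans (∑-children e _) (trans (∑-const (allFin m) _) (trans
      (cong₂ _*_ (List.length-tabulate {n = m} id) (trans (∑-const (allFin m) 3)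
        (cong (_* 3) (List.length-tabulate {n = m} id)))) (sym (*-assoc m m 3))))

  -- Counting badly stretched edges

  Up : (Edge (suc k) → Set) → Edge k → Set
  Up G e = ∃₂ λ i j → ∀ p → G (sub e i j p)

  Up? : {G : Edge (suc k) → Set} → (∀ e → Dec (G e)) → ∀ e → Dec (Up G e)
  Up? G? e = Fin.any? λ i → Fin.any? λ j → Fin.all? λ p → G? (sub e i j p)

  -- Ups r G e: the r-th subdivision of e contains a path from end to end all of
  -- whose edges satisfy G.
  Ups : ∀ r → (Edge (r + q) → Set) → Edge q → Set
  Ups zero    G = G
  Ups (suc r) G = Ups r (Up G)

  Ups? : ∀ r {G : Edge (r + q) → Set} → (∀ e → Dec (G e)) → ∀ e → Dec (Ups r G e)
  Ups? zero    G? = G?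
  Ups? (suc r) G? = Ups? r (Up? G?)

  -- The m * m paths replacing an edge are edge-disjoint, so each of them
  -- contributes a failure of its own.
  failures-Up : {G : Edge (suc k) → Set} (G? : ∀ e → Dec (G e)) →
    m * m * ∑ (edges k) (failures (Up? G?)) ≤ ∑ (edges (suc k)) (failures G?)
  failures-Up {k} {G} G? = begin
    m * m * ∑ (edges k) (failures (Up? G?))                  ≡⟨ *-distrib-∑ (m * m) (edges k) _ ⟩
    ∑ (edges k) (λ e → m * m * failures (Up? G?) e)          ≤⟨ ∑-mono-≤ (edges k) step ⟩
    ∑ (edges k) (λ e → ∑ (children e) (failures G?))         ≡⟨ ∑-concatMap children (edges k) _ ⟨
    ∑ (edges (suc k)) (failures G?)                          ∎
    where
    open ≤-Reasoning
    step : ∀ e → m * m * failures (Up? G?) e ≤ ∑ (children e) (failures G?)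
    step e with Up? G? e
    ... | yes _ = ≤-trans (≤-reflexive (*-zeroʳ (m * m))) z≤n
    ... | no ¬up = ∑-children-≥ e (failures G?) 1 some
      where
      some : ∀ i j → 1 ≤ ∑ (allFin 3) (failures G? ∘ sub e i j)
      some i j with p , ¬g ← Fin.¬∀⟶∃¬ 3 _ (λ p → G? (sub e i j p)) (λ g → ¬up (i , j , g)) =
        subst (_≤ _) (failures-¬ G? ¬g) (∑-∈ (failures G? ∘ sub e i j) (∈-allFin p))

  failures-Ups : ∀ r {G : Edge (r + q) → Set} (G? : ∀ e → Dec (G e)) →
    (m * m) ^ r * ∑ (edges q) (failures (Ups? r G?)) ≤ ∑ (edges (r + q)) (failures G?)
  failures-Ups zero    G? = ≤-reflexive (+-identityʳ _)
  failures-Ups {q} (suc r) G? = begin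
    m * m * (m * m) ^ r * ∑ (edges q) (failures (Ups? r (Up? G?)))    ≡⟨ *-assoc (m * m) _ _ ⟩
    m * m * ((m * m) ^ r * ∑ (edges q) (failures (Ups? r (Up? G?))))  ≤⟨ *-monoʳ-≤ (m * m) (failures-Ups r (Up? G?)) ⟩
    m * m * ∑ (edges (r + q)) (failures (Up? G?))                     ≤⟨ failures-Up G? ⟩
    ∑ (edges (suc r + q)) (failures G?)                               ∎
    where open ≤-Reasoning

  -- The model uses many of the parallel paths at once, so its absence yields one failing edge per
  -- `e` and not one per path. Unlike `failures-Up`, this gains no factor `m * m`.
  failures-children : {G : Edge (suc k) → Set} (G? : ∀ e → Dec (G e)) →
    (∀ e → ¬ (∀ i j p → G (sub e i j p))) →
    edgeCount k ≤ ∑ (edges (suc k)) (failures G?)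
  failures-children {k} {G} G? h = begin
    edgeCount k                                        ≡⟨ length-edges k ⟨
    length (edges k)                                   ≡⟨ *-identityʳ _ ⟨
    length (edges k) * 1                               ≡⟨ ∑-const (edges k) 1 ⟨
    ∑ (edges k) (λ _ → 1)                              ≤⟨ ∑-mono-≤ (edges k) some ⟩
    ∑ (edges k) (λ e → ∑ (children e) (failures G?))   ≡⟨ ∑-concatMap children (edges k) _ ⟨
    ∑ (edges (suc k)) (failures G?)                    ∎
    where
    open ≤-Reasoning
    some : ∀ e → 1 ≤ ∑ (children e) (failures G?)
    some e
      with i , ¬i ← Fin.¬∀⟶∃¬ m _ (λ i → Fin.all? λ j → Fin.all? λ p → G? (sub e i j p)) (h e)
      with j , ¬j ← Fin.¬∀⟶∃¬ m _ (λ j → Fin.all? λ p → G? (sub e i j p)) ¬i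
      with p , ¬g ← Fin.¬∀⟶∃¬ 3 _ (λ p → G? (sub e i j p)) ¬j =
      subst (_≤ _) (failures-¬ G? ¬g) (∑-∈ (failures G?) (∈-children e i j p))

  -- The models sit on the edges of level `q`. Level `q + 1` has a failure for each of them, and
  -- these multiply by `m * m` on the way to level `q + 2` and on each of the `suc r` levels beyond.
  failures-≥ : ∀ r q {G : Edge (suc r + suc (suc q)) → Set} (G? : ∀ e → Dec (G e)) →
    (∀ e → ¬ (∀ i j p → Up (Ups (suc r) G) (sub {q} e i j p))) →
    (m * m) ^ suc r * (m * m * edgeCount q) ≤ ∑ (edges (suc r + suc (suc q))) (failures G?)
  failures-≥ r q G? h = ≤-trans
    (*-monoʳ-≤ ((m * m) ^ suc r) (≤-trans
      (*-monoʳ-≤ (m * m) (failures-children (Up? (Ups? (suc r) G?)) h))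
      (failures-Up (Ups? (suc r) G?))))
    (failures-Ups (suc r) G?)

  edgeCount-^ : ∀ k → edgeCount k ≡ (m * m) ^ k * 3 ^ k
  edgeCount-^ zero    = refl
  edgeCount-^ (suc k) = trans (cong (_* (m * m * 3)) (edgeCount-^ k)) (shuffle ((m * m) ^ k) (3 ^ k) (m * m))
    where
    shuffle : ∀ x y c → x * y * (c * 3) ≡ c * x * (3 * y)
    shuffle = solve-∀

  -- Scale `r` places the models at level `i ∸ r`. The bound `K` then does not depend on `r`, and
  -- `edgeCount (3 + i)` is `27 * (m * m) * K`. The remaining factor 2 of 54 is the loss in
  -- `layers≤2*`.
  stretch-≥ : ∀ i (D : Edge (suc (suc (suc i))) → ℕ) →
    (∀ r q → (eq : suc r + suc (suc q) ≡ suc (suc (suc i))) →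
      ∀ e → ¬ (∀ i j p → Up (Ups (suc r) (λ g → D (subst Edge eq g) < 3 ^ r)) (sub {q} e i j p))) →
    suc i * edgeCount (suc (suc (suc i))) ≤ 54 * (m * m) * ∑ (edges (suc (suc (suc i)))) D
  stretch-≥ i D h = begin
    suc i * edgeCount (3 + i)               ≡⟨ cong (suc i *_) (edgeCount-^ (3 + i)) ⟩
    suc i * ((m * m) ^ (3 + i) * 3 ^ (3 + i)) ≡⟨ shuffle (suc i) (m * m) ((m * m) ^ (2 + i)) (3 ^ i) ⟩
    27 * (m * m) * (suc i * K)              ≤⟨ *-monoʳ-≤ (27 * (m * m)) (∑-layers (suc i) (edges (3 + i)) D K scale) ⟩
    27 * (m * m) * (2 * ∑ (edges (3 + i)) D)  ≡⟨ shuffle₂ (m * m) (∑ (edges (3 + i)) D) ⟩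
    54 * (m * m) * ∑ (edges (3 + i)) D      ∎
    where
    open ≤-Reasoning
    K = (m * m) ^ (2 + i) * 3 ^ i
    shuffle : ∀ u c x y → u * (c * x * (3 * (3 * (3 * y)))) ≡ 27 * c * (u * (x * y))
    shuffle = solve-∀
    shuffle₂ : ∀ c x → 27 * c * (2 * x) ≡ 54 * c * x
    shuffle₂ = solve-∀
    -- The level `k` is kept variable so that `eq` can be matched with `refl`.
    scale′ : ∀ k (D : Edge k → ℕ) r q (eq : suc r + suc (suc q) ≡ k) →
      (∀ e → ¬ (∀ i j p → Up (Ups (suc r) (λ g → D (subst Edge eq g) < 3 ^ r)) (sub {q} e i j p))) →
      (m * m) ^ suc r * (m * m * edgeCount q) ≤ ∑ (edges k) (failures (λ g → D g <? 3 ^ r))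
    scale′ _ D r q refl h = failures-≥ r q (λ g → D g <? 3 ^ r) h
    scale : ∀ r → r < suc i → K ≤ 3 ^ r * ∑ (edges (3 + i)) (failures (λ g → D g <? 3 ^ r))
    scale r (s≤s r≤i) = begin
      (m * m) ^ (2 + i) * 3 ^ i
        ≡⟨ cong (λ n → (m * m) ^ (2 + n) * 3 ^ n) (m+[n∸m]≡n r≤i) ⟨
      (m * m) ^ (2 + (r + q′)) * 3 ^ (r + q′)
        ≡⟨ cong₂ (λ x y → m * m * (m * m * x) * y) (^-distribˡ-+-* (m * m) r q′) (^-distribˡ-+-* 3 r q′) ⟩
      m * m * (m * m * ((m * m) ^ r * (m * m) ^ q′)) * (3 ^ r * 3 ^ q′)
        ≡⟨ shuffle₃ (m * m) ((m * m) ^ r) ((m * m) ^ q′) (3 ^ r) (3 ^ q′) ⟩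
      3 ^ r * ((m * m) ^ suc r * (m * m * ((m * m) ^ q′ * 3 ^ q′)))
        ≡⟨ cong (λ n → 3 ^ r * ((m * m) ^ suc r * (m * m * n))) (edgeCount-^ q′) ⟨
      3 ^ r * ((m * m) ^ suc r * (m * m * edgeCount q′))
        ≤⟨ *-monoʳ-≤ (3 ^ r) (scale′ (3 + i) D r q′ eq (h r q′ eq)) ⟩
      3 ^ r * ∑ (edges (3 + i)) (failures (λ g → D g <? 3 ^ r))
        ∎
      where
      q′ = i ∸ r
      eq : suc r + suc (suc q′) ≡ 3 + i
      eq = cong suc (trans (+-suc r (suc q′)) (cong suc (trans (+-suc r q′) (cong suc (m+[n∸m]≡n r≤i)))))
      shuffle₃ : ∀ c x y u v → c * (c * (x * y)) * (u * v) ≡ u * (c * x * (c * (y * v)))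
      shuffle₃ = solve-∀

  -- Finiteness of the index types

  edge↔ : ∀ k → Edge k ↔ Fin (edgeCount k)
  edge↔ zero    = ↔-trans (mk↔ₛ′ (λ _ → tt) (λ _ → root) (λ _ → refl) (λ { root → refl })) (↔-sym Fin.1↔⊤)
  edge↔ (suc k) = ↔-trans split
    (↔-trans (edge↔ k ×-↔ ↔-trans (↔-sym Fin.*↔× ×-↔ ↔-refl) (↔-sym Fin.*↔×)) (↔-sym Fin.*↔×))
    where
    split : Edge (suc k) ↔ (Edge k × (Fin m × Fin m) × Fin 3)
    split = mk↔ₛ′ (λ { (sub e i j p) → e , (i , j) , p }) (λ { (e , (i , j) , p) → sub e i j p })
      (λ { (e , (i , j) , p) → refl }) (λ { (sub e i j p) → refl })

  vertexCount : ℕ → ℕ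
  vertexCount zero    = 2
  vertexCount (suc k) = vertexCount k + (edgeCount k * m + edgeCount k * m)

  vert↔ : ∀ k → Vert k ↔ Fin (vertexCount k)
  vert↔ zero    = mk↔ₛ′ (λ { s → 0F ; t → 1F }) from (λ { 0F → refl ; 1F → refl }) (λ { s → refl ; t → refl })
    where
    from : Fin 2 → Vert 0
    from 0F = s
    from 1F = t
  vert↔ (suc k) = ↔-trans split
    (↔-trans (vert↔ k ⊎-↔ ↔-trans (inner ⊎-↔ inner) (↔-sym Fin.+↔⊎)) (↔-sym Fin.+↔⊎))
    where
    split : Vert (suc k) ↔ (Vert k ⊎ (Edge k × Fin m ⊎ Edge k × Fin m))
    split = mk↔ₛ′
      (λ { (old v) → inj₁ v ; (a e i) → inj₂ (inj₁ (e , i)) ; (b e j) → inj₂ (inj₂ (e , j)) })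
      (λ { (inj₁ v) → old v ; (inj₂ (inj₁ (e , i))) → a e i ; (inj₂ (inj₂ (e , j))) → b e j })
      (λ { (inj₁ v) → refl ; (inj₂ (inj₁ (e , i))) → refl ; (inj₂ (inj₂ (e , j))) → refl })
      (λ { (old v) → refl ; (a e i) → refl ; (b e j) → refl })
    inner : (Edge k × Fin m) ↔ Fin (edgeCount k * m)
    inner = ↔-trans (edge↔ k ×-↔ ↔-refl) (↔-sym Fin.*↔×)

  -- The graphs `H k` and their connectedness

  -- Linear interpolation along the paths replacing the edges.
  ext : (Vert k → ℕ) → Vert (suc k) → ℕ
  ext f (old v) = 3 * f v
  ext f (a e i) = 2 * f (src e) + f (tgt e)
  ext f (b e j) = f (src e) + 2 * f (tgt e)

  rank : Vert k → ℕ
  rank {zero}  s = 0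
  rank {zero}  t = 1
  rank {suc k} v = ext rank v

  -- Interpolation spreads three times the rise of an edge over three edges, so the rise stays 1.
  -- This rules out loops.
  rank-tgt : ∀ (e : Edge k) → rank (tgt e) ≡ suc (rank (src e))
  rank-tgt root = refl
  rank-tgt (sub e i j 0F) rewrite rank-tgt e = lin (rank (src e))
    where
    lin : ∀ x → 2 * x + suc x ≡ suc (3 * x)
    lin = solve-∀
  rank-tgt (sub e i j 1F) rewrite rank-tgt e = lin (rank (src e))
    where
    lin : ∀ x → x + 2 * suc x ≡ suc (2 * x + suc x)
    lin = solve-∀
  rank-tgt (sub e i j 2F) rewrite rank-tgt e = lin (rank (src e))
    where
    lin : ∀ x → 3 * suc x ≡ suc (x + 2 * suc x)
    lin = solve-∀

  -- Indices with the same ends give a single edge of the simple graph `H k`, yet each index is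
  -- subdivided separately at the next level and counted separately in averages.
  Joins : Rel (Vert k) 0ℓ
  Joins u v = ∃ λ e → src e ≡ u × tgt e ≡ v

  joins? : ∀ (u v : Vert k) → Dec (Joins u v)
  joins? {k} u v = map′ (λ (i , p) → Inverse.from (edge↔ k) i , p)
    (λ (e , p , p′) → Inverse.to (edge↔ k) e , trans (cong src (from∘to (edge↔ k) e)) p , trans (cong tgt (from∘to (edge↔ k) e)) p′)
    (Fin.any? λ i → decEq (vert↔ k) (src (Inverse.from (edge↔ k) i)) u
              ×-dec decEq (vert↔ k) (tgt (Inverse.from (edge↔ k) i)) v)

  joins-irrefl : ∀ (u : Vert k) → ¬ Joins u u
  joins-irrefl u (e , refl , eq) = 1+n≢n (trans (sym (rank-tgt e)) (cong rank eq))

  H : ℕ → Graph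
  H k = undirected (vert↔ k) Joins joins? joins-irrefl

  vertex : Vert k → Vertex (H k)
  vertex {k} = Inverse.to (vert↔ k)

  Adj : Rel (Vert k) 0ℓ
  Adj {k} = Joined (vert↔ k) Joins joins? joins-irrefl

  module _ (o : Fin m) where
    -- The index `o` ensures `m > 0`; without parallel paths a subdivision would delete the edge.
    refine : ∀ {u v : Vert k} → Adj u v → Star Adj (old u) (old v)
    refine (inj₁ (e , refl , refl)) =
      inj₁ (sub e o o 0F , refl , refl) ◅ inj₁ (sub e o o 1F , refl , refl) ◅ inj₁ (sub e o o 2F , refl , refl) ◅ ε
    refine (inj₂ (e , refl , refl)) =
      inj₂ (sub e o o 2F , refl , refl) ◅ inj₂ (sub e o o 1F , refl , refl) ◅ inj₂ (sub e o o 0F , refl , refl) ◅ ε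

    base : ∀ k → Vert k
    base zero    = s
    base (suc k) = old (base k)

    toBase : ∀ {k} (v : Vert k) → Star Adj v (base k)
    toBase s       = ε
    toBase t       = inj₂ (root , refl , refl) ◅ ε
    toBase (old v) = kleisliStar old refine (toBase v)
    toBase (a e i) = inj₂ (sub e i o 0F , refl , refl) ◅ kleisliStar old refine (toBase (src e))
    toBase (b e j) = inj₁ (sub e o j 2F , refl , refl) ◅ kleisliStar old refine (toBase (tgt e))

    H-connected : ∀ k → Connected (H k)
    H-connected k = connectedIn (vert↔ k) Joins joins? joins-irrefl (λ _ → ⊤) (λ _ → ⊤) _ _ {base k} tt
      (λ {x} _ → Star.map (λ j → j , tt , tt) (toBase x))

  -- The tree decomposition

  -- No two of the vertices `b e j` are adjacent, so each gets a leaf of its own below a centre that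
  -- holds the ends of `e` and all `a e i`.
  data Node : ℕ → Set where
    top    : Node 0
    keep   : Node k → Node (suc k)
    centre : Edge k → Node (suc k)
    leaf   : Edge k → Fin m → Node (suc k)

  nodeCount : ℕ → ℕ
  nodeCount zero    = 1
  nodeCount (suc k) = nodeCount k + (edgeCount k + edgeCount k * m)

  node↔ : ∀ k → Node k ↔ Fin (nodeCount k)
  node↔ zero    = ↔-trans (mk↔ₛ′ (λ _ → tt) (λ _ → top) (λ _ → refl) (λ { top → refl })) (↔-sym Fin.1↔⊤)
  node↔ (suc k) = ↔-trans split
    (↔-trans (node↔ k ⊎-↔ ↔-trans (edge↔ k ⊎-↔ ↔-trans (edge↔ k ×-↔ ↔-refl) (↔-sym Fin.*↔×)) (↔-sym Fin.+↔⊎))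
      (↔-sym Fin.+↔⊎))
    where
    split : Node (suc k) ↔ (Node k ⊎ (Edge k ⊎ Edge k × Fin m))
    split = mk↔ₛ′
      (λ { (keep x) → inj₁ x ; (centre e) → inj₂ (inj₁ e) ; (leaf e j) → inj₂ (inj₂ (e , j)) })
      (λ { (inj₁ x) → keep x ; (inj₂ (inj₁ e)) → centre e ; (inj₂ (inj₂ (e , j))) → leaf e j })
      (λ { (inj₁ x) → refl ; (inj₂ (inj₁ e)) → refl ; (inj₂ (inj₂ (e , j))) → refl })
      (λ { (keep x) → refl ; (centre e) → refl ; (leaf e j) → refl })

  -- A node whose bag contains both ends of the edge; the nodes for the subdivided edge are hung
  -- below it.
  node : Edge k → Node k
  node root          = top
  node (sub e i j p) = leaf e j

  parent : Node k → Maybe (Node k)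
  parent top        = nothing
  parent (keep x)   = Maybe.map keep (parent x)
  parent (centre e) = just (keep (node e))
  parent (leaf e j) = just (centre e)

  depth : Node k → ℕ
  depth top        = 0
  depth (keep x)   = depth x
  depth (centre e) = suc (depth (node e))
  depth (leaf e j) = suc (suc (depth (node e)))

  deeper : ∀ {x y : Node k} → parent x ≡ just y → depth y < depth x
  deeper {x = keep x} eq with parent x in up
  deeper {x = keep x} refl | just y = deeper {x = x} up
  deeper {x = centre e} refl = ≤-refl
  deeper {x = leaf e j} refl = ≤-refl

  rootNode : ∀ k → Node k
  rootNode zero    = top
  rootNode (suc k) = keep (rootNode k)

  rootNode-unique : ∀ (x : Node k) → x ≡ rootNode k ⊎ ∃ λ y → parent x ≡ just y
  rootNode-unique top        = inj₁ refl
  rootNode-unique (keep x) with rootNode-unique x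
  ... | inj₁ eq       = inj₁ (cong keep eq)
  ... | inj₂ (y , up) = inj₂ (keep y , cong (Maybe.map keep) up)
  rootNode-unique (centre e) = inj₂ (_ , refl)
  rootNode-unique (leaf e j) = inj₂ (_ , refl)

  centreBag : Edge k → List (Vert (suc k))
  centreBag e = old (src e) ∷ old (tgt e) ∷ map (a e) (allFin m)

  bag : Node k → List (Vert k)
  bag top        = s ∷ t ∷ []
  bag (keep x)   = map old (bag x)
  bag (centre e) = centreBag e
  bag (leaf e j) = b e j ∷ centreBag e

  length-centreBag : ∀ (e : Edge k) → length (centreBag e) ≡ suc (suc m)
  length-centreBag e = cong (2 +_) (trans (List.length-map (a e) (allFin m)) (List.length-tabulate {n = m} id))

  length-bag : ∀ (x : Node k) → length (bag x) ≤ suc (suc (suc m))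
  length-bag top        = s≤s (s≤s z≤n)
  length-bag (keep x)   = ≤-trans (≤-reflexive (List.length-map old (bag x))) (length-bag x)
  length-bag (centre e) = ≤-trans (≤-reflexive (length-centreBag e)) (n≤1+n _)
  length-bag (leaf e j) = s≤s (≤-reflexive (length-centreBag e))

  a∈centreBag : ∀ (e : Edge k) i → a e i ∈ centreBag e
  a∈centreBag e i = there (there (∈-map⁺ (a e) (∈-allFin i)))

  ends∈node : ∀ (e : Edge k) → src e ∈ bag (node e) × tgt e ∈ bag (node e)
  ends∈node root           = here refl , there (here refl)
  ends∈node (sub e i j 0F) = there (here refl) , there (a∈centreBag e i)
  ends∈node (sub e i j 1F) = there (a∈centreBag e i) , here refl
  ends∈node (sub e i j 2F) = here refl , there (there (here refl))

  -- The node closest to the root among those whose bags contain the vertex.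
  home : Vert k → Node k
  home s       = top
  home t       = top
  home (old v) = keep (home v)
  home (a e i) = centre e
  home (b e j) = leaf e j

  ∈home : ∀ (v : Vert k) → v ∈ bag (home v)
  ∈home s       = here refl
  ∈home t       = there (here refl)
  ∈home (old v) = ∈-map⁺ old (∈home v)
  ∈home (a e i) = a∈centreBag e i
  ∈home (b e j) = here refl

  ∈parent : ∀ {v : Vert k} x → v ∈ bag x → x ≡ home v ⊎ ∃ λ y → parent x ≡ just y × v ∈ bag y
  ∈parent top (here refl)         = inj₁ refl
  ∈parent top (there (here refl)) = inj₁ refl
  ∈parent (keep x) v∈ with v , v∈x , refl ← ∈-map⁻ old v∈ with ∈parent x v∈x
  ... | inj₁ refl           = inj₁ refl
  ... | inj₂ (y , up , v∈y) = inj₂ (keep y , cong (Maybe.map keep) up , ∈-map⁺ old v∈y)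
  ∈parent (centre e) (here refl) = inj₂ (_ , refl , ∈-map⁺ old (proj₁ (ends∈node e)))
  ∈parent (centre e) (there (here refl)) = inj₂ (_ , refl , ∈-map⁺ old (proj₂ (ends∈node e)))
  ∈parent (centre e) (there (there v∈)) with i , _ , refl ← ∈-map⁻ (a e) v∈ = inj₁ refl
  ∈parent (leaf e j) (here refl) = inj₁ refl
  ∈parent (leaf e j) (there v∈)  = inj₂ (_ , refl , v∈)

  H-treewidth : ∀ k → TreewidthAtMost (suc (suc m)) (H k)
  H-treewidth k = rootedTree-treewidth (node↔ k) parent depth (λ {x} → deeper {x = x}) (vert↔ k) Joins joins? joins-irrefl
    (rootNode k) rootNode-unique bag length-bag
    (λ { (e , refl , refl) → node e , ends∈node e }) home ∈home (λ {_} {x} → ∈parent x)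

  -- Interpolated functions as certificates of distance

  Lipschitz : (Vert k → ℕ) → Set
  Lipschitz f = ∀ e → f (src e) ≤ suc (f (tgt e)) × f (tgt e) ≤ suc (f (src e))

  -- With values x and y at the ends of an edge, the interpolated values are 3x, 2x + y, x + 2y, 3y.
  -- Consecutive differences are all y - x, as before.
  ext-Lipschitz : ∀ {f : Vert k → ℕ} → Lipschitz f → Lipschitz (ext f)
  ext-Lipschitz {f = f} lip (sub e i j p) = step p
    where
    x y : ℕ
    x = f (src e)
    y = f (tgt e)
    shift : ∀ u {v w c d} → c ≡ u + v → u + suc w ≡ suc d → v ≤ suc w → c ≤ suc d
    shift u c≡ ≡d v≤ = ≤-trans (≤-reflexive c≡) (≤-trans (+-monoʳ-≤ u v≤) (≤-reflexive ≡d))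
    e₁ : ∀ x → 3 * x ≡ 2 * x + x
    e₁ = solve-∀
    e₂ : ∀ u y → u + suc y ≡ suc (u + y)
    e₂ = solve-∀
    e₃ : ∀ x → 2 * x + suc x ≡ suc (3 * x)
    e₃ = solve-∀
    e₄ : ∀ x y → 2 * x + y ≡ (x + y) + x
    e₄ = solve-∀
    e₅ : ∀ x y → (x + y) + suc y ≡ suc (x + 2 * y)
    e₅ = solve-∀
    e₆ : ∀ x y → x + 2 * y ≡ (x + y) + y
    e₆ = solve-∀
    e₇ : ∀ x y → (x + y) + suc x ≡ suc (2 * x + y)
    e₇ = solve-∀
    e₈ : ∀ x y → x + 2 * y ≡ 2 * y + x
    e₈ = solve-∀
    e₀ : ∀ x y → 2 * y + suc x ≡ suc (x + 2 * y)
    e₀ = solve-∀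
    step : ∀ p → ext f (src (sub e i j p)) ≤ suc (ext f (tgt (sub e i j p)))
               × ext f (tgt (sub e i j p)) ≤ suc (ext f (src (sub e i j p)))
    step 0F = shift (2 * x) (e₁ x) (e₂ (2 * x) y) (proj₁ (lip e)) , shift (2 * x) refl (e₃ x) (proj₂ (lip e))
    step 1F = shift (x + y) (e₄ x y) (e₅ x y) (proj₁ (lip e)) , shift (x + y) (e₆ x y) (e₇ x y) (proj₂ (lip e))
    step 2F = shift (2 * y) (e₈ x y) (e₃ y) (proj₁ (lip e)) , shift (2 * y) (e₁ y) (e₀ x y) (proj₂ (lip e))

  exts : ∀ r → (Vert q → ℕ) → Vert (r + q) → ℕ
  exts zero    f = f
  exts (suc r) f = ext (exts r f)

  exts-Lipschitz : ∀ r {f : Vert q → ℕ} → Lipschitz f → Lipschitz (exts r f)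
  exts-Lipschitz zero    lip = lip
  exts-Lipschitz (suc r) lip = ext-Lipschitz (exts-Lipschitz r lip)

  emb : ∀ r → Vert q → Vert (r + q)
  emb zero    v = v
  emb (suc r) v = old (emb r v)

  -- Inside r h x holds for the vertices x of the r-th subdivision of the edge h:
  -- they see a function on Vert q only through its values at the ends of h.
  Inside : ∀ r → Edge q → Vert (r + q) → Set
  Inside r h x = ∀ f c → f (src h) ≡ c → f (tgt h) ≡ c → exts r f x ≡ 3 ^ r * c

  Step : ∀ r → Edge q → (Edge (r + q) → Set) → Rel (Vert (r + q)) 0ℓ
  Step r h G u v = ∃ λ e → src e ≡ u × tgt e ≡ v × G e × Inside r h (src e) × Inside r h (tgt e)

  -- `Inside` survives subdivision because both interpolation formulas have total weight 3: equal
  -- values c at the ends of an edge become 3c at its inner vertices.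
  trail : ∀ r {G : Edge (r + q) → Set} h → Ups r G h →
    Star (Step r h G) (emb r (src h)) (emb r (tgt h))
  trail zero h g = (h , refl , refl , g ,
    (λ f c p _ → trans p (sym (+-identityʳ c))) , (λ f c _ p → trans p (sym (+-identityʳ c)))) ◅ ε
  trail {q} (suc r) {G} h g = kleisliStar old refineStep (trail r h g)
    where
    refineStep : ∀ {u v} → Step r h (Up G) u v → Star (Step (suc r) h G) (old u) (old v)
    refineStep (e , refl , refl , (i , j , g) , is , it) =
      (sub e i j 0F , refl , refl , g 0F , is′ , ia) ◅
      (sub e i j 1F , refl , refl , g 1F , ia , ib) ◅
      (sub e i j 2F , refl , refl , g 2F , ib , it′) ◅ ε
      where
      lin₁ : ∀ y → 2 * y + y ≡ 3 * y
      lin₁ = solve-∀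
      is′ : Inside (suc r) h (old (src e))
      is′ f c p p′ = trans (cong (3 *_) (is f c p p′)) (sym (*-assoc 3 (3 ^ r) c))
      it′ : Inside (suc r) h (old (tgt e))
      it′ f c p p′ = trans (cong (3 *_) (it f c p p′)) (sym (*-assoc 3 (3 ^ r) c))
      ia : Inside (suc r) h (a e i)
      ia f c p p′ = trans (cong₂ (λ x y → 2 * x + y) (is f c p p′) (it f c p p′))
        (trans (lin₁ (3 ^ r * c)) (sym (*-assoc 3 (3 ^ r) c)))
      ib : Inside (suc r) h (b e j)
      ib f c p p′ = trans (cong₂ (λ x y → x + 2 * y) (is f c p p′) (it f c p p′))
        (sym (*-assoc 3 (3 ^ r) c))

  inside-src : ∀ r (h : Edge q) → Inside r h (emb r (src h))
  inside-src zero    h f c p p′ = trans p (sym (+-identityʳ c))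
  inside-src (suc r) h f c p p′ = trans (cong (3 *_) (inside-src r h f c p p′)) (sym (*-assoc 3 (3 ^ r) c))

  walk-Lipschitz : ∀ {f : Vert k → ℕ} → Lipschitz f → ∀ {u v l} → Walk (H k) u v l →
    f (Inverse.from (vert↔ k) v) ≤ f (Inverse.from (vert↔ k) u) + l
  walk-Lipschitz lip [] = m≤m+n _ 0
  walk-Lipschitz {k} {f} lip {u} {v} {suc l} (_∷_ {v = w} e p) = begin
    f (from v)             ≤⟨ walk-Lipschitz {f = f} lip p ⟩
    f (from w) + l         ≤⟨ +-monoˡ-≤ l (step (~⁻ (vert↔ k) Joins joins? joins-irrefl e)) ⟩
    suc (f (from u)) + l   ≡⟨ +-suc (f (from u)) l ⟨
    f (from u) + suc l     ∎
    where
    open ≤-Reasoning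
    open Inverse (vert↔ k) using (from)
    step : ∀ {x y} → Adj x y → f y ≤ suc (f x)
    step (inj₁ (e , refl , refl)) = proj₂ (lip e)
    step (inj₂ (e , refl , refl)) = proj₁ (lip e)

  -- The 0-1 indicator function of a vertex set is 1-Lipschitz whatever the set,
  -- so its extension separates edges on different sides by 3 ^ r.
  separated : ∀ r {h h′ : Edge q} {P : Vert q → Set} (P? : ∀ v → Dec (P v)) →
    P (src h) → P (tgt h) → ¬ P (src h′) → ¬ P (tgt h′) →
    ∀ {x x′} → Inside r h x → Inside r h′ x′ →
    ∀ {l} → Walk (H (r + q)) (vertex x) (vertex x′) l → 3 ^ r ≤ l
  separated {q} r {h} {h′} P? ps pt ¬ps ¬pt {x} {x′} ix ix′ {l} p = begin
    3 ^ r                               ≡⟨ *-identityʳ _ ⟨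
    3 ^ r * 1                           ≡⟨ ix′ χ 1 (failures-¬ P? ¬ps) (failures-¬ P? ¬pt) ⟨
    f x′                                ≡⟨ cong f (from∘to (vert↔ (r + q)) x′) ⟨
    f (from (vertex x′))                ≤⟨ walk-Lipschitz {f = f} (exts-Lipschitz r {χ} χ-Lipschitz) p ⟩
    f (from (vertex x)) + l             ≡⟨ cong (λ y → f y + l) (from∘to (vert↔ (r + q)) x) ⟩
    f x + l                             ≡⟨ cong (_+ l) (ix χ 0 (failures-holds P? ps) (failures-holds P? pt)) ⟩
    3 ^ r * 0 + l                       ≡⟨ cong (_+ l) (*-zeroʳ (3 ^ r)) ⟩
    l                                   ∎
    where
    open ≤-Reasoning
    open Inverse (vert↔ (r + q)) using (from)
    χ : Vert q → ℕ
    χ = failures P?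
    f : Vert (r + q) → ℕ
    f = exts r χ
    χ≤1 : ∀ v → χ v ≤ 1
    χ≤1 v with P? v
    ... | yes _ = z≤n
    ... | no  _ = ≤-refl
    χ-Lipschitz : Lipschitz χ
    χ-Lipschitz e = ≤-trans (χ≤1 _) (s≤s z≤n) , ≤-trans (χ≤1 _) (s≤s z≤n)

  -- The minor in a dominating graph

  module Embedding (r q T : ℕ) (0<T : 0 < T) (2T≤3^r : T + T ≤ 3 ^ r)
    (e : Edge q) (o : Fin m) {U : Graph}
    (Φ : Vertex (H (r + suc (suc q))) → Vertex U)
    (d : Vertex (H (r + suc (suc q))) → Vertex (H (r + suc (suc q))) → ℕ)
    (isDistance : ∀ x y → Distance U (Φ x) (Φ y) (d x y))
    (dominating : ∀ x y l → Distance (H (r + suc (suc q))) x y l → l ≤ d x y)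
    where
    open Graph U using (_~_)

    Short : Edge (r + suc (suc q)) → Set
    Short g = d (vertex (src g)) (vertex (tgt g)) < T

    φ : Vert (r + suc (suc q)) → Vertex U
    φ v = Φ (vertex v)

    -- The radius `T` is just large enough to contain the shortest walks in `U` that replace short
    -- edges, and small enough for two such neighbourhoods to be kept apart by `2T≤3^r`.
    Near : Edge (suc (suc q)) → Pred (Vertex U) 0ℓ
    Near h y = ∃ λ x → Inside r h x × ∃ λ l → l < T × Walk U (φ x) y l

    Within : Pred (Vertex U) 0ℓ → Rel (Vertex U) 0ℓ
    Within P x y = x ~ y × P x × P y

    -- A common vertex would join the images of `x` and `x′` by a walk of fewer than `T + T` steps,
    -- which domination carries back to `H`.
    near-separated : ∀ {h h′} {P : Vert (suc (suc q)) → Set} (P? : ∀ v → Dec (P v)) →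
      P (src h) → P (tgt h) → ¬ P (src h′) → ¬ P (tgt h′) →
      ∀ {y} → Near h y → ¬ Near h′ y
    near-separated P? ps pt ¬ps ¬pt (x , ix , l , l< , w) (x′ , ix′ , l′ , l′< , w′) =
      ¬¬-distance (proj₂ (Star⇒Walk (proj₂ (H-connected o _) (vertex x) (vertex x′) tt tt))) λ k dist →
        <-irrefl refl (begin-strict
          3 ^ r                  ≤⟨ separated r P? ps pt ¬ps ¬pt ix ix′ (proj₁ dist) ⟩
          k                          ≤⟨ dominating _ _ k dist ⟩
          d (vertex x) (vertex x′)   ≤⟨ proj₂ (isDistance _ _) _ (w ++ᵂ reverseᵂ w′) ⟩
          l + l′                     <⟨ +-mono-< l< l′< ⟩
          T + T                      ≤⟨ 2T≤3^r ⟩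
          3 ^ r                  ∎)
      where open ≤-Reasoning

    -- `j` counts the steps already made from `φ x`, so each vertex passed is still within `T` of
    -- the same `φ x`.
    near-walk : ∀ {h x y z j l} → Inside r h x → Walk U (φ x) y j → Walk U y z l → j + l < T →
      Star (Within (Near h)) y z
    near-walk ix p [] j+l< = ε
    near-walk {h} {x} {j = j} {suc l} ix p (_∷_ {v = y′} e′ w) j+l< =
      (e′ , (x , ix , j , ≤-<-trans (m≤m+n j (suc l)) j+l< , p)
          , (x , ix , j + 1 , ≤-<-trans (m≤m+n (j + 1) l) j+1+l< , p ++ᵂ e′ ∷ [])) ◅
      near-walk ix (p ++ᵂ e′ ∷ []) w j+1+l<
      where
      j+1+l< : j + 1 + l < T
      j+1+l< = subst (_< T) (sym (+-assoc j 1 l)) j+l<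

    near-trail : ∀ h → Ups r Short h →
      Star (Within (Near h)) (φ (emb r (src h))) (φ (emb r (tgt h)))
    near-trail h g = kleisliStar φ short (trail r h g)
      where
      short : ∀ {u v} → Step r h Short u v → Star (Within (Near h)) (φ u) (φ v)
      short (e , refl , refl , d< , is , _) = near-walk is [] (proj₁ (isDistance _ _)) d<

    near-src : ∀ h → Near h (φ (emb r (src h)))
    near-src h = _ , inside-src r h , 0 , 0<T , []

    -- The vertices of one walk in `N`, listed so that the branch sets built from such walks are
    -- decidable; `Near` itself is an existential statement about walks.
    record Cover (N : Pred (Vertex U) 0ℓ) (u v : Vertex U) : Set where
      field
        verts  : List (Vertex U)
        sound  : ∀ {z} → z ∈ verts → N z
        start  : u ∈ verts
        end    : v ∈ verts
        linked : ∀ {z} → z ∈ verts → Star (Within (_∈ verts)) u z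

    cover : ∀ {N : Pred (Vertex U) 0ℓ} {u v} → N u → Star (Within N) u v → Cover N u v
    cover {u = u} Nu ε = record
      { verts  = u ∷ []
      ; sound  = λ { (here refl) → Nu }
      ; start  = here refl
      ; end    = here refl
      ; linked = λ { (here refl) → ε }
      }
    cover {u = u} Nu ((e′ , _ , Nw) ◅ es) = record
      { verts  = u ∷ Cover.verts rest
      ; sound  = λ { (here refl) → Nu ; (there z∈) → Cover.sound rest z∈ }
      ; start  = here refl
      ; end    = there (Cover.end rest)
      ; linked = λ { (here refl) → ε
                   ; (there z∈) → (e′ , here refl , there (Cover.start rest)) ◅
                       Star.map (λ (e , x∈ , y∈) → e , there x∈ , there y∈) (Cover.linked rest z∈) }
      }
      where rest = cover Nw es

    module Model (good : ∀ i j p → Up (Ups r Short) (sub e i j p)) where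

      -- `p` selects the edge s  -  a i or a i  -  b j, and `c` a third of the good path that
      -- replaces it. The edge b j  -  t is never selected, so `branch` may take arbitrary values
      -- beside it.
      piece : Fin m → Fin m → Fin 2 → Fin 3 → Edge (suc (suc q))
      piece i j p c = sub (sub e i j (inject₁ p)) (proj₁ (good i j (inject₁ p))) (proj₁ (proj₂ (good i j (inject₁ p)))) c

      piece-good : ∀ i j p c → Ups r Short (piece i j p c)
      piece-good i j p = proj₂ (proj₂ (good i j (inject₁ p)))

      cov : ∀ i j p c → let h = piece i j p c in
        Cover (Near h) (φ (emb r (src h))) (φ (emb r (tgt h)))
      cov i j p c = cover (near-src (piece i j p c)) (near-trail (piece i j p c) (piece-good i j p c))

      -- Each inner vertex of the pieces gets the branch of the vertex of
      -- s, a i, b j that it is next to; a i and b i share the branch suc i.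
      branch : Vert (suc (suc q)) → Fin (suc m)
      branch (old (old _))      = zero
      branch (old (a _ i))      = suc i
      branch (old (b _ j))      = suc j
      branch (a (sub _ i j 0F) _) = zero
      branch (b (sub _ i j 0F) _) = suc i
      branch (a (sub _ i j 1F) _) = suc i
      branch (b (sub _ i j 1F) _) = suc j
      branch (a (sub _ i j 2F) _) = suc j
      branch (b (sub _ i j 2F) _) = zero

      Within-branch : Fin (suc m) → Fin m → Fin m → Fin 2 → Fin 3 → Set
      Within-branch x i j p c = branch (src (piece i j p c)) ≡ x × branch (tgt (piece i j p c)) ≡ x

      -- Only pieces with both ends in branch `x` enter. On these the 0-1 function of the branch
      -- takes equal values at the two ends, which is what `near-separated` asks for.
      A : Fin (suc m) → Pred (Vertex U) 0ℓ
      A x y = ∃₂ λ i j → ∃₂ λ p c → Within-branch x i j p c × y ∈ Cover.verts (cov i j p c)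

      A? : ∀ x y → Dec (A x y)
      A? x y = Fin.any? λ i → Fin.any? λ j → Fin.any? λ p → Fin.any? λ c →
        ((branch (src (piece i j p c)) Fin.≟ x) ×-dec (branch (tgt (piece i j p c)) Fin.≟ x))
          ×-dec Any.any? (y Fin.≟_) (Cover.verts (cov i j p c))

      A-disjoint : ∀ {x x′ y} → A x y → A x′ y → x ≡ x′
      A-disjoint {x} {x′} (i , j , p , c , (s≡ , t≡) , y∈) (i′ , j′ , p′ , c′ , (s≡′ , t≡′) , y∈′)
        with x Fin.≟ x′
      ... | yes eq = eq
      ... | no x≢x′ = contradiction (Cover.sound (cov i′ j′ p′ c′) y∈′)
        (near-separated (λ v → branch v Fin.≟ x) s≡ t≡
          (λ eq → x≢x′ (trans (sym eq) s≡′)) (λ eq → x≢x′ (trans (sym eq) t≡′))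
          (Cover.sound (cov i j p c) y∈))

      module _ {x} i j p c (w : Within-branch x i j p c) where
        from-src : ∀ {y} → y ∈ Cover.verts (cov i j p c) →
          Star (Within (A x)) (φ (emb r (src (piece i j p c)))) y
        from-src y∈ = Star.map (λ (e , u∈ , v∈) → e , (i , j , p , c , w , u∈) , (i , j , p , c , w , v∈))
          (Cover.linked (cov i j p c) y∈)

        across : Star (Within (A x)) (φ (emb r (src (piece i j p c)))) (φ (emb r (tgt (piece i j p c))))
        across = from-src (Cover.end (cov i j p c))

        from-tgt : ∀ {y} → y ∈ Cover.verts (cov i j p c) →
          Star (Within (A x)) (φ (emb r (tgt (piece i j p c)))) y
        from-tgt y∈ = Star.reverse (λ (e , Au , Av) → Graph.symm U _ _ e , Av , Au) across ◅◅ from-src y∈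

      -- Branch `zero` is a bundle of outer thirds at s. In branch `suc x` there are bundles at a x
      -- and at b x, and the path with `i = j = x` connects them.
      hub : ∀ x → ∃ λ c → A x c × (∀ y → A x y → Star (Within (A x)) c y)
      hub zero = φ (emb r (old (old (src e)))) ,
        (o , o , 0F , 0F , (refl , refl) , Cover.start (cov o o 0F 0F)) , spoke
        where
        spoke : ∀ y → A zero y → Star (Within (A zero)) (φ (emb r (old (old (src e))))) y
        spoke y (i , j , 0F , 0F , w , y∈) = from-src i j 0F 0F w y∈
        spoke y (i , j , 0F , 1F , (_ , ()) , _)
        spoke y (i , j , 0F , 2F , (() , _) , _)
        spoke y (i , j , 1F , 0F , (() , _) , _)
        spoke y (i , j , 1F , 1F , (() , _) , _)
        spoke y (i , j , 1F , 2F , (() , _) , _)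
      hub (suc x) = φ (emb r (old (a e x))) ,
        (x , x , 1F , 0F , (refl , refl) , Cover.start (cov x x 1F 0F)) , spoke
        where
        spoke : ∀ y → A (suc x) y → Star (Within (A (suc x))) (φ (emb r (old (a e x)))) y
        spoke y (i , j , 0F , 0F , (() , _) , _)
        spoke y (i , j , 0F , 1F , (() , _) , _)
        spoke y (i , j , 0F , 2F , w@(refl , _) , y∈) = from-tgt i j 0F 2F w y∈
        spoke y (i , j , 1F , 0F , w@(refl , _) , y∈) = from-src i j 1F 0F w y∈
        spoke y (i , j , 1F , 1F , w@(refl , refl) , y∈) =
          across x x 1F 0F (refl , refl) ◅◅ from-src x x 1F 1F w y∈
        -- The bundle at b x is reached from a x through all three thirds of the edge between them.
        spoke y (i , j , 1F , 2F , w@(refl , _) , y∈) =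
          across x x 1F 0F (refl , refl) ◅◅ across x x 1F 1F (refl , refl) ◅◅
          across x x 1F 2F (refl , refl) ◅◅ from-tgt i j 1F 2F w y∈

      kind : ∀ {i j : Fin m} → Dec (i ≡ j) → Fin 2
      kind (yes _) = 0F
      kind (no _)  = 1F

      left : ∀ {i j : Fin m} → Dec (i ≡ j) → Fin (suc m)
      left         (yes _) = zero
      left {i = i} (no _)  = suc i

      -- The middle third of s — a i (from the path i = j) or of a i — b j (i ≠ j).
      strand : Fin m × Fin m → Edge (suc (suc q))
      strand (i , j) = piece i j (kind (i Fin.≟ j)) 1F

      l r′ : Fin m × Fin m → Fin (suc m)
      l (i , j)  = left (i Fin.≟ j)
      r′ (i , j) = suc j

      branch-src : ∀ c → branch (src (strand c)) ≡ l c
      branch-src (i , j) with i Fin.≟ j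
      ... | yes _ = refl
      ... | no _  = refl

      branch-tgt : ∀ c → branch (tgt (strand c)) ≡ r′ c
      branch-tgt (i , j) with i Fin.≟ j
      ... | yes refl = refl
      ... | no _     = refl

      l≢r : ∀ c → l c ≢ r′ c
      l≢r (i , j) with i Fin.≟ j
      ... | yes _  = λ ()
      ... | no i≢j = i≢j ∘ Fin.suc-injective

      src∈A : ∀ c → A (l c) (φ (emb r (src (strand c))))
      src∈A (i , j) with i Fin.≟ j
      ... | yes _ = i , j , 0F , 0F , (refl , refl) , Cover.end (cov i j 0F 0F)
      ... | no _  = i , j , 1F , 0F , (refl , refl) , Cover.end (cov i j 1F 0F)

      tgt∈A : ∀ c → A (r′ c) (φ (emb r (tgt (strand c))))
      tgt∈A (i , j) with i Fin.≟ j
      ... | yes refl = i , j , 0F , 2F , (refl , refl) , Cover.start (cov i j 0F 2F)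
      ... | no _     = i , j , 1F , 2F , (refl , refl) , Cover.start (cov i j 1F 2F)

      -- The ends of a strand may lie in different branches, so the separating set is the union of
      -- the two; a piece of a third branch has both ends outside it.
      strand-branch : ∀ {c x y} → Near (strand c) y → A x y → x ≡ l c ⊎ x ≡ r′ c
      strand-branch {c} {x} near (i , j , p , k , (s≡ , t≡) , y∈) with x Fin.≟ l c | x Fin.≟ r′ c
      ... | yes eq | _      = inj₁ eq
      ... | no _   | yes eq = inj₂ eq
      ... | no x≢l | no x≢r = contradiction (Cover.sound (cov i j p k) y∈)
        (near-separated (λ v → (branch v Fin.≟ l c) ⊎-dec (branch v Fin.≟ r′ c))
          (inj₁ (branch-src c)) (inj₂ (branch-tgt c))
          [ (λ eq → x≢l (trans (sym s≡) eq)) , (λ eq → x≢r (trans (sym s≡) eq)) ]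
          [ (λ eq → x≢l (trans (sym t≡) eq)) , (λ eq → x≢r (trans (sym t≡) eq)) ] near)

      path : Vert (suc (suc q)) → Maybe (Fin m × Fin m)
      path (old _)           = nothing
      path (a (sub _ i j _) _) = just (i , j)
      path (b (sub _ i j _) _) = just (i , j)

      -- Strands are middle thirds, so both ends are inner vertices that carry the index of their
      -- own path. The vertices with that index form the separating set.
      strand-disjoint : ∀ {c c′ y} → Near (strand c) y → Near (strand c′) y → c ≡ c′
      strand-disjoint {c} {c′} near near′ with Product.≡-dec Fin._≟_ Fin._≟_ c c′
      ... | yes eq = eq
      ... | no c≢c′ = contradiction near′
        (near-separated (λ v → Maybe.≡-dec (Product.≡-dec Fin._≟_ Fin._≟_) (path v) (just c))
          refl refl
          (λ eq → c≢c′ (sym (Maybe.just-injective eq))) (λ eq → c≢c′ (sym (Maybe.just-injective eq))) near)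

      left-refl : ∀ j → l (j , j) ≡ zero
      left-refl j with j Fin.≟ j
      ... | yes _  = refl
      ... | no j≢j = contradiction refl j≢j

      left-≢ : ∀ {i j} → i ≢ j → l (i , j) ≡ suc i
      left-≢ {i} {j} i≢j with i Fin.≟ j
      ... | yes i≡j = contradiction i≡j i≢j
      ... | no _    = refl

      joined : ∀ x y → x ≢ y → (∃ λ c → l c ≡ x × r′ c ≡ y) ⊎ (∃ λ c → l c ≡ y × r′ c ≡ x)
      joined zero    zero    x≢y = contradiction refl x≢y
      joined zero    (suc j) x≢y = inj₁ ((j , j) , left-refl j , refl)
      joined (suc i) zero    x≢y = inj₂ ((i , i) , left-refl i , refl)
      joined (suc i) (suc j) x≢y = inj₁ ((i , j) , left-≢ (x≢y ∘ cong suc) , refl)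

      anyPair? : {P : Fin m × Fin m → Set} → (∀ c → Dec (P c)) → Dec (∃ P)
      anyPair? P? = map′ (λ (i , j , p) → (i , j) , p) (λ ((i , j) , p) → i , j , p)
        (Fin.any? λ i → Fin.any? λ j → P? (i , j))

      -- All pairs of distinct branch sets are joined and `M` has no loops, so every `M` on `m + 1`
      -- vertices is obtained.
      minor : ∀ M → order M ≡ suc m → M ≼ U
      minor M@(record {}) refl = strandModel A A? A-disjoint hub (Fin m × Fin m) anyPair? l r′ l≢r
        (λ c → Near (strand c))
        (λ c → _ , _ , src∈A c , tgt∈A c , near-src (strand c) ,
          near-trail (strand c) (piece-good _ _ _ _))
        (λ {c} → strand-branch {c}) (λ {c} → strand-disjoint {c})
        (λ x y e → joined x y λ { refl → Graph.irrefl M x e })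

  -- The size of `H k` and the averaged lower bound

  edge-distance : ∀ (e : Edge k) → Distance (H k) (vertex (src e)) (vertex (tgt e)) 1
  edge-distance {k} e = ~⁺ (vert↔ k) Joins joins? joins-irrefl (inj₁ (e , refl , refl)) ∷ [] , positive refl refl
    where
    positive : ∀ {u v} → vertex (src e) ≡ u → vertex (tgt e) ≡ v → ∀ l → Walk (H k) u v l → 1 ≤ l
    positive p p′ (suc l) w  = s≤s z≤n
    positive p p′ zero    [] = contradiction (e , refl , sym (injective (trans p (sym p′)))) (joins-irrefl (src e))
      where
      injective : ∀ {x y} → vertex {k} x ≡ vertex y → x ≡ y
      injective {x} {y} eq = trans (sym (from∘to (vert↔ k) x)) (trans (cong (Inverse.from (vert↔ k)) eq) (from∘to (vert↔ k) y))

  edgeCount-≤ : ∀ {Q} → m * m ≤ Q → ∀ k → edgeCount k ≤ 2 ^ (Q * 3 * k)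
  edgeCount-≤ {Q} mm≤Q zero    = m^n>0 2 (Q * 3 * 0)
  edgeCount-≤ {Q} mm≤Q (suc k) = begin
    edgeCount k * (m * m * 3)             ≤⟨ *-mono-≤ (edgeCount-≤ mm≤Q k) (*-monoˡ-≤ 3 mm≤Q) ⟩
    2 ^ (Q * 3 * k) * (Q * 3)             ≤⟨ *-monoʳ-≤ (2 ^ (Q * 3 * k)) (n≤2^n (Q * 3)) ⟩
    2 ^ (Q * 3 * k) * 2 ^ (Q * 3)         ≡⟨ ^-distribˡ-+-* 2 (Q * 3 * k) (Q * 3) ⟨
    2 ^ (Q * 3 * k + Q * 3)               ≡⟨ cong (2 ^_) (trans (+-comm _ (Q * 3)) (sym (*-suc (Q * 3) k))) ⟩
    2 ^ (Q * 3 * suc k)                   ∎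
    where open ≤-Reasoning

  -- The 5 is 3 + 2: the edges take `Q * 3` per level, and the factor `m * 2` for new vertices is at
  -- most 2 ^ (Q * 2). Adding old and new vertices doubles the bound, which the exponent of one more
  -- level absorbs.
  vertexCount-≤ : ∀ {Q} → 1 ≤ Q → m ≤ Q → m * m ≤ Q → ∀ k → vertexCount k ≤ 2 ^ (Q * 5 * suc k)
  vertexCount-≤ {Q} 1≤Q m≤Q mm≤Q zero = ^-monoʳ-≤ 2 {1} (*-mono-≤ (*-mono-≤ 1≤Q (s≤s (z≤n {4}))) (s≤s (z≤n {0})))
  vertexCount-≤ {Q} 1≤Q m≤Q mm≤Q (suc k) = begin
    vertexCount k + (edgeCount k * m + edgeCount k * m)
      ≤⟨ +-mono-≤ (vertexCount-≤ 1≤Q m≤Q mm≤Q k) new ⟩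
    2 ^ (Q * 5 * suc k) + 2 ^ (Q * 5 * suc k)
      ≡⟨ cong (2 ^ (Q * 5 * suc k) +_) (+-identityʳ _) ⟨
    2 ^ suc (Q * 5 * suc k)
      ≤⟨ ^-monoʳ-≤ 2 (+-monoˡ-≤ (Q * 5 * suc k) (*-mono-≤ 1≤Q (s≤s (z≤n {4})))) ⟩
    2 ^ (Q * 5 + Q * 5 * suc k)
      ≡⟨ cong (2 ^_) (*-suc (Q * 5) (suc k)) ⟨
    2 ^ (Q * 5 * suc (suc k))
      ∎
    where
    open ≤-Reasoning
    double : ∀ x y → x * y + x * y ≡ x * (y * 2)
    double = solve-∀
    collect : ∀ Q k → Q * 3 * k + Q * 2 + (Q * 3 + Q * 2 * k) ≡ Q * 5 * suc k
    collect = solve-∀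
    new : edgeCount k * m + edgeCount k * m ≤ 2 ^ (Q * 5 * suc k)
    new = begin
      edgeCount k * m + edgeCount k * m    ≡⟨ double (edgeCount k) m ⟩
      edgeCount k * (m * 2)                ≤⟨ *-mono-≤ (edgeCount-≤ mm≤Q k) (*-monoˡ-≤ 2 m≤Q) ⟩
      2 ^ (Q * 3 * k) * (Q * 2)            ≤⟨ *-monoʳ-≤ (2 ^ (Q * 3 * k)) (n≤2^n (Q * 2)) ⟩
      2 ^ (Q * 3 * k) * 2 ^ (Q * 2)        ≡⟨ ^-distribˡ-+-* 2 (Q * 3 * k) (Q * 2) ⟨
      2 ^ (Q * 3 * k + Q * 2)              ≤⟨ ^-monoʳ-≤ 2 (m≤m+n (Q * 3 * k + Q * 2) (Q * 3 + Q * 2 * k)) ⟩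
      2 ^ (Q * 3 * k + Q * 2 + (Q * 3 + Q * 2 * k)) ≡⟨ cong (2 ^_) (collect Q k) ⟩
      2 ^ (Q * 5 * suc k)                  ∎

  -- The exponent of the vertex bound is `Q * 5 * (4 + i)`, at most `20 * Q * suc i`, and 1080 is 20
  -- times 54. One factor `Q = suc m * suc m` comes from the logarithm and one from bounding
  -- `m * m`, whence the fourth power.
  log-stretch : ∀ i S → suc i * edgeCount (3 + i) ≤ 54 * (m * m) * S →
    ⌊log₂ vertexCount (3 + i) ⌋ * edgeCount (3 + i) ≤ 1080 * suc m ^ 4 * S
  log-stretch i S h = begin
    ⌊log₂ vertexCount (3 + i) ⌋ * E      ≤⟨ *-monoˡ-≤ E (⌊log₂⌋-mono-≤ (vertexCount-≤ 1≤Q m≤Q mm≤Q (3 + i))) ⟩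
    ⌊log₂ 2 ^ (Q * 5 * (4 + i)) ⌋ * E    ≡⟨ cong (_* E) (⌊log₂[2^n]⌋≡n (Q * 5 * (4 + i))) ⟩
    Q * 5 * (4 + i) * E                  ≤⟨ *-monoˡ-≤ E (*-monoʳ-≤ (Q * 5) (≤-trans (m≤m+n (4 + i) (3 * i)) (≤-reflexive (four i)))) ⟩
    Q * 5 * (4 * suc i) * E              ≡⟨ regroup Q (suc i) E ⟩
    20 * Q * (suc i * E)                 ≤⟨ *-monoʳ-≤ (20 * Q) h ⟩
    20 * Q * (54 * (m * m) * S)          ≤⟨ *-monoʳ-≤ (20 * Q) (*-monoˡ-≤ S (*-monoʳ-≤ 54 mm≤Q)) ⟩
    20 * Q * (54 * Q * S)                ≡⟨ regroup₂ (suc m) S ⟩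
    1080 * suc m ^ 4 * S                 ∎
    where
    open ≤-Reasoning
    E = edgeCount (3 + i)
    Q = suc m * suc m
    1≤Q : 1 ≤ Q
    1≤Q = s≤s z≤n
    m≤Q : m ≤ Q
    m≤Q = ≤-trans (n≤1+n m) (m≤m+n (suc m) (m * suc m))
    mm≤Q : m * m ≤ Q
    mm≤Q = *-mono-≤ (n≤1+n m) (n≤1+n m)
    four : ∀ i → 4 + i + 3 * i ≡ 4 * suc i
    four = solve-∀
    regroup : ∀ Q i E → Q * 5 * (4 * i) * E ≡ 20 * Q * (i * E)
    regroup = solve-∀
    regroup₂ : ∀ n S → 20 * (n * n) * (54 * (n * n) * S) ≡ 1080 * (n * (n * (n * (n * 1)))) * S
    regroup₂ = solve-∀

  module _ (o : Fin m) where
    m>0 : 0 < m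
    m>0 = ≤-<-trans z≤n (Fin.toℕ<n o)

    edgeCount>0 : ∀ k → 0 < edgeCount k
    edgeCount>0 zero    = s≤s z≤n
    edgeCount>0 (suc k) = *-mono-≤ (edgeCount>0 k) (*-mono-≤ (*-mono-≤ m>0 m>0) (s≤s (z≤n {2})))

    H-increasing : ∀ k → order (H k) < order (H (suc k))
    H-increasing k = m<m+n (vertexCount k) (≤-trans (*-mono-≤ (edgeCount>0 k) m>0) (m≤m+n _ _))

    -- `Embedding` is used with `suc r` subdivisions and radius 3 ^ r, as twice the radius must not
    -- exceed 3 ^ (r + 1).
    not-all-short : ∀ {k U} (Φ : Vertex (H k) → Vertex U) (d : Vertex (H k) → Vertex (H k) → ℕ) →
      (∀ x y → Distance U (Φ x) (Φ y) (d x y)) →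
      (∀ x y l → Distance (H k) x y l → l ≤ d x y) →
      ∀ M → order M ≡ suc m → ¬ (M ≼ U) →
      ∀ r q (eq : suc r + suc (suc q) ≡ k) e →
      ¬ (∀ i j p → Up (Ups (suc r) (λ g → d (vertex (src (subst Edge eq g))) (vertex (tgt (subst Edge eq g))) < 3 ^ r))
                      (sub {q} e i j p))
    not-all-short Φ d isDistance dominating M order≡ M⋠U r q refl e good =
      M⋠U (Embedding.Model.minor (suc r) q (3 ^ r) (m^n>0 3 r) (+-monoʳ-≤ (3 ^ r) (m≤m+n (3 ^ r) _))
        e o Φ d isDistance dominating good M order≡)

    -- The ends of an edge have distance 1, so each index has expected stretch at most `α`; the
    -- number of indices cancels.
    averaged : ∀ {ℓ} {F : Pred Graph ℓ} k c α (D : Distribution F (H k)) (approx : IsApproximation α D) →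
      (∀ j → Distribution.InSupport D j → ⌊log₂ vertexCount k ⌋ * edgeCount k ≤
        c * ∑ (edges k) (λ e → IsApproximation.d approx j (vertex (src e)) (vertex (tgt e)))) →
      fromℕ ⌊log₂ order (H k) ⌋ ≤ℝ c · α
    averaged k c α D approx stretch =
      fromℕ-cancel {edgeCount k} {⌊log₂ vertexCount k ⌋} {c} {α} (edgeCount>0 k)
        (subst (λ n → (⌊log₂ vertexCount k ⌋ * n) · 1ℝ ≤ℝ (c * n) · α) (length-edges k)
          (averaging weight D′ α (edges k) (⌊log₂ vertexCount k ⌋ * length (edges k)) c nonneg total
            (λ e N → ≤ℝ-trans {partialSum (λ j → D′ j e · weight j) N} {1 · α} {α}
              (expected (vertex (src e)) (vertex (tgt e)) 1 (edge-distance e) N) (proj₁ (+ℝ.identityʳ α)))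
            (λ j w>0 → subst (λ n → ⌊log₂ vertexCount k ⌋ * n ≤ c * ∑ (edges k) (D′ j))
              (sym (length-edges k)) (stretch j w>0))))
      where
      open Distribution D
      open IsApproximation approx
      D′ : ℕ → Edge k → ℕ
      D′ j e = d j (vertex (src e)) (vertex (tgt e))

    lower-bound : ∀ {ℓ} {F : Pred Graph ℓ} M → order M ≡ suc m → F Excludes M →
      ∀ i α (D : Distribution F (H (3 + i))) → IsApproximation α D →
      fromℕ ⌊log₂ order (H (3 + i)) ⌋ ≤ℝ (1080 * suc m ^ 4) · α
    lower-bound M order≡ excludes i α D approx = averaged (3 + i) (1080 * suc m ^ 4) α D approx
      λ j w>0 → log-stretch i (∑ (edges (3 + i)) (stretch j)) (stretch-≥ i (stretch j)
        (not-all-short (Φ j) (d j) (isDistance j w>0) (dominating j w>0) M order≡ (excludes (U j) (U∈F j))))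
      where
      open Distribution D
      open IsApproximation approx
      stretch : ℕ → Edge (3 + i) → ℕ
      stretch j e = d j (vertex (src e)) (vertex (tgt e))

-- Excluded graphs with at most one vertex

module StarGraph (N : ℕ) where
  parent : Fin (suc N) → Maybe (Fin (suc N))
  parent zero    = nothing
  parent (suc _) = just zero

  depth : Fin (suc N) → ℕ
  depth zero    = 0
  depth (suc _) = 1

  deeper : ∀ {x y} → parent x ≡ just y → depth y < depth x
  deeper {suc _} refl = s≤s z≤n

  parent-root : ∀ x → x ≡ zero ⊎ ∃ λ y → parent x ≡ just y
  parent-root zero    = inj₁ refl
  parent-root (suc _) = inj₂ (zero , refl)

  star : Graph
  star = rootedTree ↔-refl parent depth deeper

  star-connected : Connected star
  star-connected = proj₁ (rootedTree-isTree ↔-refl parent depth deeper zero parent-root)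

  star-treewidth : ∀ w → TreewidthAtMost (suc w) star
  star-treewidth w = rootedTree-treewidth ↔-refl parent depth deeper ↔-refl
    (Below ↔-refl parent depth deeper) (below? ↔-refl parent depth deeper) (below-irrefl ↔-refl parent depth deeper)
    zero parent-root (λ x → zero ∷ x ∷ []) (λ _ → s≤s (s≤s z≤n))
    (λ { {suc x} refl → suc x , there (here refl) , here refl })
    id (λ _ → there (here refl)) up
    where
    up : ∀ {x t} → x ∈ zero ∷ t ∷ [] → t ≡ x ⊎ ∃ λ t′ → parent t ≡ just t′ × x ∈ zero ∷ t′ ∷ []
    up {t = zero}  (here refl)         = inj₁ refl
    up {t = suc _} (here refl)         = inj₂ (zero , refl , here refl)
    up             (there (here refl)) = inj₁ refl

subsingletonMinor : ∀ {M U} → (∀ (x y : Vertex M) → x ≡ y) → Vertex U → M ≼ U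
subsingletonMinor {M} {U} unique u = minorModel (λ _ y → y ≡ u) (λ _ y → y Fin.≟ u) (λ _ _ → unique _ _)
  (λ _ → u , refl , λ { _ refl → ε })
  (λ x y e → contradiction (subst (λ z → Graph._~_ M x z) (unique y x) e) (Graph.irrefl M x))

-- The lower bound for every excluded graph

LowerBound : ∀ {ℓ} → Pred Graph ℓ → Graph → Set ℓ
LowerBound F M = ∃ λ (H : ℕ → Graph) →
  (∀ i → order (H i) < order (H (suc i))) ×
  (∀ i → Connected (H i)) ×
  (∀ i → TreewidthAtMost (suc (order M)) (H i)) ×
  (∀ i (α : ℝ) (D : Distribution F (H i)) → IsApproximation α D →
    fromℕ ⌊log₂ order (H i) ⌋ ≤ℝ (1080 * order M ^ 4) · α)

-- Any graph with a vertex has such an `M` as a minor, and `Φ` supplies a vertex of `U`, so no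
-- distribution over `F` exists. Stars provide connected graphs of growing order.
starBound : ∀ {ℓ} {F : Pred Graph ℓ} {M} → F Excludes M → (∀ (x y : Vertex M) → x ≡ y) → LowerBound F M
starBound {F = F} {M} excludes unique =
  star , (λ i → ≤-refl) , star-connected , (λ i → star-treewidth i (order M)) ,
  λ i α D approx → contradiction (subsingletonMinor unique (Distribution.Φ D 0 zero))
    (excludes (Distribution.U D 0) (Distribution.U∈F D 0))
  where
  open StarGraph

lowerBound : ∀ {ℓ} {F : Pred Graph ℓ} M → F Excludes M → LowerBound F M
lowerBound record { order = 0 } excludes = starBound excludes λ ()
lowerBound record { order = 1 } excludes = starBound excludes λ { zero zero → refl }
lowerBound M@record { order = suc (suc m) } excludes =
  -- Level 3 is the first with room for a scale: two subdivisions for the model and one for `r = 0`.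
  (λ i → H (3 + i)) , (λ i → H-increasing zero (3 + i)) , (λ i → H-connected zero (3 + i)) ,
  (λ i → H-treewidth (3 + i)) , lower-bound zero M refl excludes
  where
  open Construction (suc m)

theorem1 : (ℓ : Level) →
    ∃₂ λ (C e : ℕ) →
    (F : Pred Graph ℓ) → MinorClosed F →
    (M : Graph) → F Excludes M →
    ∃ λ (H : ℕ → Graph) →
    (∀ i → order (H i) < order (H (suc i))) ×
    (∀ i → Connected (H i)) ×
    (∀ i → TreewidthAtMost (suc (order M)) (H i)) ×
    (∀ i (α : ℝ) (D : Distribution F (H i)) → IsApproximation α D →
    fromℕ ⌊log₂ order (H i) ⌋ ≤ℝ (C * order M ^ e) · α)
theorem1 ℓ = 1080 , 4 , λ F _ M excludes → lowerBound M excludes
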